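{- Let $d$ be a positive integer and let $\mathcal{F}\subseteq \binom{\mathbb{N}}{d}$ be a finite compressed set. Then for any $\mathcal{F}'\subseteq \binom{\mathbb{N}}{d}$ with $|\mathcal{F}'|=|\mathcal{F}|$ one has $|\mathrm{Inc}(\mathcal{F}')|\ge|\mathrm{Inc}(\mathcal{F})|$.
   Context: $\mathbb{N}=\{1,2,3,\dots\}$ and $\binom{\mathbb{N}}{d}$ is the set of $d$-element subsets of $\mathbb{N}$; each $\mathbf{u}\in\binom{\mathbb{N}}{d}$ is written $\mathbf{u}=(u_1,\dots,u_d)$ with $u_1<\dots<u_d$. The squashed order on $\binom{\mathbb{N}}{d}$: $\mathbf{u}<\mathbf{v}$ if the largest element of the symmetric difference $(\mathbf{u}\setminus\mathbf{v})\cup(\mathbf{v}\setminus\mathbf{u})$ belongs to $\mathbf{v}$. A finite family $\mathcal{F}\subseteq\binom{\mathbb{N}}{d}$ is compressed if it consists of the $|\mathcal{F}|$ smallest elements of $\binom{\mathbb{N}}{d}$ in the squashed order. Let $\mathrm{Inc}_1$ be the set of maps $\pi:\mathbb{N}\to\mathbb{N}$ with $\pi(j)<\pi(j+1)$ and $\pi(j)\le j+1$ for all $j\ge1$; such $\pi$ acts by $\pi(\mathbf{u})=(\pi(u_1),\dots,\pi(u_d))$. For $\mathcal{F}\subseteq\binom{\mathbb{N}}{d}$, $\mathrm{Inc}(\mathcal{F})=\{\pi(\mathbf{u})\mid \mathbf{u}\in\mathcal{F},\ \pi\in\mathrm{Inc}_1\}$. -}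

module Defs where

open import Data.Nat using (ℕ; _≤_; _<_)
open import Data.Product using (Σ; ∃; _×_; _,_)
open import Data.Vec using (Vec; lookup; map)
open import Data.Fin using (Fin; suc; inject₁)
open import Data.List using (List; length)
open import Data.List.Relation.Unary.Unique.Propositional using (Unique)
import Data.List.Membership.Propositional as L
import Data.Vec.Membership.Propositional as V
open import Function.Bundles using (_⇔_)
open import Relation.Nullary using (¬_)
open import Relation.Binary.PropositionalEquality using (_≡_)

-- A d-element subset u = (u_1 < … < u_d) of ℕ = {1,2,3,…} is represented
-- by the vector (u_1,…,u_d) of Agda naturals, which must be strictly
-- increasing and have u_1 ≥ 1 (Agda's ℕ contains 0, the paper's does not).
-- With this canonical representation, equality of sets is equality of vectors.
IsDSet : {d : ℕ} → Vec ℕ d → Set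
IsDSet {d} u =
  (∀ (i : Fin d) → 1 ≤ lookup u i) ×
  (∀ (i : Fin d) (j : Fin d) → Data.Fin.toℕ i < Data.Fin.toℕ j → lookup u i < lookup u j)
  where import Data.Fin

-- Squashed order: u < v iff the largest element of the symmetric difference
-- of u and v belongs to v; i.e. there is x ∈ v with x ∉ u such that no
-- element larger than x lies in the symmetric difference.
_≺_ : {d : ℕ} → Vec ℕ d → Vec ℕ d → Set
u ≺ v = ∃ λ x → (x V.∈ v) × (¬ (x V.∈ u)) ×
          (∀ y → x < y → ((y V.∈ u) ⇔ (y V.∈ v)))

IsFamily : {d : ℕ} → List (Vec ℕ d) → Set
IsFamily F = Unique F × (∀ u → u L.∈ F → IsDSet u)

-- F is compressed: it consists of the |F| smallest d-sets in the squashed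
-- order, i.e. every member of F is smaller than every d-set not in F.
Compressed : {d : ℕ} → List (Vec ℕ d) → Set
Compressed {d} F = ∀ (u w : Vec ℕ d) → u L.∈ F → IsDSet w → ¬ (w L.∈ F) → u ≺ w

-- Inc_1: maps π : ℕ → ℕ with π(j) < π(j+1), π(j) ≤ j+1 for all j ≥ 1,
-- and π(j) ∈ ℕ = {1,2,…} for j ≥ 1 (values at 0 are irrelevant).
IsInc1 : (ℕ → ℕ) → Set
IsInc1 π = ∀ j → 1 ≤ j → (1 ≤ π j) × (π j < π (ℕ.suc j)) × (π j ≤ ℕ.suc j)

Inc : {d : ℕ} → List (Vec ℕ d) → Vec ℕ d → Set
Inc F v = ∃ λ u → (u L.∈ F) × ∃ λ (π : ℕ → ℕ) → IsInc1 π × (map π u ≡ v)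

HasSize : {d : ℕ} → (Vec ℕ d → Set) → ℕ → Set
HasSize {d} P n = ∃ λ (xs : List (Vec ℕ d)) →
  Unique xs × (∀ x → (x L.∈ xs) ⇔ P x) × (length xs ≡ n)

{-# OPTIONS --safe #-}

-- Replacing a d-set u by its gaps g_i = u_i - u_(i-1) - 1 turns it into a vector of ℕ^d,
-- and turns Inc(F) into N(F) = F ∪ (F + e_1) ∪ … ∪ (F + e_d): a map of Inc_1 fixes an
-- initial part of u and shifts the rest by one. For an initial segment F with n elements,
-- |N(F)| = n + γ_d(n) for an explicit function γ_d, computed by recursion along the
-- squashed order. For the lower bound |N(F)| ≥ n + γ_d(n) on arbitrary F, let a and b be
-- the numbers of elements of F with first coordinate zero and positive. Inductively the
-- elements of N(F) with first coordinate zero number at least a + γ_(d-1)(a), and the other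
-- ones at least b + γ_d(b); the latter also number at least a + b since they include F + e_1.
-- So everything reduces to γ_d(a + b) ≤ γ_(d-1)(a) + max(γ_d(b), a).

module Submission where

open import Defs
open import Data.Empty using (⊥; ⊥-elim)
open import Data.Fin using (Fin; zero; suc; fromℕ; inject₁; toℕ)
open import Data.Fin.Properties using (toℕ-fromℕ; toℕ-inject₁; toℕ<n)
open import Data.Fin.Relation.Unary.Top using (view; ‵fromℕ; ‵inject₁)
open import Data.List as List
  using (List; []; _∷_; [_]; _++_; length; map; filter; concatMap; deduplicate)
open import Data.List.Properties using (length-map; length-++)
open import Data.List.Membership.Propositional using (_∈_; find; lose)
open import Data.List.Membership.Propositional.Properties
open import Data.List.Relation.Binary.Subset.Propositional using (_⊆_)
open import Data.List.Relation.Unary.All as All using ([]; _∷_)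
open import Data.List.Relation.Unary.AllPairs using ([]; _∷_)
open import Data.List.Relation.Unary.Any using (here; there)
open import Data.List.Relation.Unary.Unique.Propositional using (Unique)
import Data.List.Relation.Unary.Unique.DecPropositional.Properties as DecUnique
import Data.List.Relation.Unary.Unique.Propositional.Properties as Unique
open import Data.Nat
open import Data.Nat.Properties
open import Data.Nat.Tactic.RingSolver using (solve-∀)
open import Data.Product using (∃; _×_; _,_; proj₁; proj₂)
open import Data.Sum using (_⊎_; inj₁; inj₂)
open import Data.Vec as Vec using (Vec; []; _∷_; _∷ʳ_; sum; lookup; _[_]%=_)
import Data.Vec.Membership.Propositional as V
open import Data.Vec.Properties using (≡-dec; ∷-injective; ∷ʳ-injective; map-∷ʳ)
import Data.Vec.Relation.Unary.Any as VAny
open import Function using (_∘_)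
open import Function.Bundles using (mk⇔; Equivalence)
open import Relation.Binary.PropositionalEquality
  using (_≡_; refl; sym; trans; cong; cong₂; subst; subst₂)
open import Relation.Nullary using (¬_; Dec; yes; no)
open import Algebra.Properties.CommutativeSemigroup +-commutativeSemigroup
  using (interchange; x∙yz≈y∙xz; x∙yz≈yx∙z; xy∙z≈y∙xz; xy∙z≈zx∙y; xy∙z≈zy∙x)
open ≤-Reasoning

-- Sizes of balls and their gain

-- The number of g ∈ ℕ^d with Σ g ≤ m, i.e. the binomial coefficient (m + d) C d;
-- the last clause separates the vectors with Σ g ≤ m from those with Σ g = m + 1.
ballSize : ℕ → ℕ → ℕ
ballSize zero    m       = 1
ballSize (suc d) zero    = 1
ballSize (suc d) (suc m) = ballSize (suc d) m + ballSize d (suc m)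

-- Enumerate the g ∈ ℕ^d with Σ g ≤ m by increasing ⊏, and write down for each g the
-- number of new elements its neighbourhood contributes, minus one. These words satisfy
--   D 0 m = [ 0 ],  D d 0 = [ d ],  D d (m + 1) = D d m ++ D (d - 1) (m + 1),
-- and gain d m n, the γ_d(n) above if m is large, is the sum of the first n letters of
-- D d m. It is constant for n ≥ ballSize d m, which is what makes the recursion free of
-- case distinctions.
gain : ℕ → ℕ → ℕ → ℕ
gain zero    m       n       = 0
gain (suc d) zero    zero    = 0
gain (suc d) zero    (suc n) = suc d
gain (suc d) (suc m) n       = gain (suc d) m n + gain d (suc m) (n ∸ ballSize (suc d) m)

gain-0 : ∀ d m → gain d m 0 ≡ 0
gain-0 zero    m       = refl
gain-0 (suc d) zero    = refl
gain-0 (suc d) (suc m)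
  rewrite 0∸n≡0 (ballSize (suc d) m) | gain-0 (suc d) m = gain-0 d (suc m)

gain-mono : ∀ d m {x y} → x ≤ y → gain d m x ≤ gain d m y
gain-mono zero    m       x≤y       = z≤n
gain-mono (suc d) zero    z≤n       = z≤n
gain-mono (suc d) zero    (s≤s x≤y) = ≤-refl
gain-mono (suc d) (suc m) x≤y       =
  +-mono-≤ (gain-mono (suc d) m x≤y)
           (gain-mono d (suc m) (∸-monoˡ-≤ (ballSize (suc d) m) x≤y))

gain-saturates : ∀ d m k → gain d m (ballSize d m + k) ≡ gain d m (ballSize d m)
gain-saturates zero    m       k = refl
gain-saturates (suc d) zero    k = refl
gain-saturates (suc d) (suc m) k = cong₂ _+_ top rest
  where
  b = ballSize (suc d) m
  b′ = ballSize d (suc m)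
  top : gain (suc d) m (b + b′ + k) ≡ gain (suc d) m (b + b′)
  top = trans (cong (gain (suc d) m) (+-assoc b b′ k))
              (trans (gain-saturates (suc d) m (b′ + k)) (sym (gain-saturates (suc d) m b′)))
  rest : gain d (suc m) (b + b′ + k ∸ b) ≡ gain d (suc m) (b + b′ ∸ b)
  rest = trans (cong (gain d (suc m)) (trans (cong (_∸ b) (+-assoc b b′ k)) (m+n∸m≡n b (b′ + k))))
         (trans (gain-saturates d (suc m) k)
                (cong (gain d (suc m)) (sym (m+n∸m≡n b b′))))

gain-full : ∀ d m {n} → ballSize d m ≤ n → gain d m n ≡ gain d m (ballSize d m)
gain-full d m {n} b≤n =
  trans (cong (gain d m) (sym (m+[n∸m]≡n b≤n))) (gain-saturates d m (n ∸ ballSize d m))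

gain-∸≡0 : ∀ d m {x y} → x ≤ y → gain d m (x ∸ y) ≡ 0
gain-∸≡0 d m x≤y = trans (cong (gain d m) (m≤n⇒m∸n≡0 x≤y)) (gain-0 d m)

-- The two cases of the concatenation `D (suc d) m ++ D d (suc m)`: here the prefix ends in the
-- first block, in `gain-above` it contains all of it.
gain-below : ∀ d m {n} → n ≤ ballSize (suc d) m → gain (suc d) (suc m) n ≡ gain (suc d) m n
gain-below d m {n} n≤b =
  trans (cong (gain (suc d) m n +_) (gain-∸≡0 d (suc m) n≤b)) (+-identityʳ _)

gain-above : ∀ d m k → let b = ballSize (suc d) m in
  gain (suc d) (suc m) (b + k) ≡ gain (suc d) m b + gain d (suc m) k
gain-above d m k =
  cong₂ _+_ (gain-saturates (suc d) m k) (cong (gain d (suc m)) (m+n∸m≡n (ballSize (suc d) m) k))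

-- Exchanging and rotating blocks of the words `D d m`

∸-swap : ∀ t a b → t ∸ a ∸ b ≡ t ∸ b ∸ a
∸-swap t a b = trans (∸-+-assoc t a b) (trans (cong (t ∸_) (+-comm a b)) (sym (∸-+-assoc t b a)))

-- Every prefix sum of D d′ m′ ++ D d m is at most that of D d m ++ D d′ m′. As this
-- relation is compatible with concatenation, it suffices to move the blocks of one
-- word past the other word.
gain-swap : ∀ d′ m′ d m → d′ ≤ d → m ≤ m′ → ∀ t →
  gain d′ m′ t + gain d m (t ∸ ballSize d′ m′) ≤ gain d m t + gain d′ m′ (t ∸ ballSize d m)
-- The word `D zero m′` is the single letter 0; putting it first merely delays the other word.
gain-swap zero m′ d m _ _ t =
  ≤-trans (gain-mono d m (m∸n≤m t 1)) (m≤m+n _ 0)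
gain-swap (suc d′) zero (suc d) zero (s≤s d′≤d) z≤n zero = ≤-refl
gain-swap (suc d′) zero (suc d) zero (s≤s d′≤d) z≤n (suc zero) = +-monoˡ-≤ 0 (s≤s d′≤d)
gain-swap (suc d′) zero (suc d) zero (s≤s d′≤d) z≤n (suc (suc t)) = ≤-reflexive (+-comm (suc d′) (suc d))
gain-swap (suc d′) (suc m′) d m d′≤d m≤m′ t with m≤n⇒m<n∨m≡n m≤m′
-- The left word splits into blocks `x₁ x₂`, and `y` moves past `x₂`, then past `x₁`. The second
-- move requires `m ≤ m′` for the smaller `m′`, hence the case distinction.
... | inj₁ (s≤s m<m′) = begin
  (x₁ t + x₂ (t ∸ a₁)) + y (t ∸ (a₁ + a₂)) ≡⟨ cong (λ z → (x₁ t + x₂ (t ∸ a₁)) + y z) (sym (∸-+-assoc t a₁ a₂)) ⟩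
  (x₁ t + x₂ (t ∸ a₁)) + y (t ∸ a₁ ∸ a₂)   ≡⟨ +-assoc (x₁ t) _ _ ⟩
  x₁ t + (x₂ (t ∸ a₁) + y (t ∸ a₁ ∸ a₂))   ≤⟨ +-monoʳ-≤ (x₁ t) (gain-swap d′ (suc m′) d m (≤-trans (n≤1+n d′) d′≤d) m≤m′ (t ∸ a₁)) ⟩
  x₁ t + (y (t ∸ a₁) + x₂ (t ∸ a₁ ∸ b))    ≡⟨ sym (+-assoc (x₁ t) _ _) ⟩
  (x₁ t + y (t ∸ a₁)) + x₂ (t ∸ a₁ ∸ b)    ≤⟨ +-monoˡ-≤ _ (gain-swap (suc d′) m′ d m d′≤d m<m′ t) ⟩
  (y t + x₁ (t ∸ b)) + x₂ (t ∸ a₁ ∸ b)     ≡⟨ +-assoc (y t) _ _ ⟩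
  y t + (x₁ (t ∸ b) + x₂ (t ∸ a₁ ∸ b))     ≡⟨ cong (λ z → y t + (x₁ (t ∸ b) + x₂ z)) (∸-swap t a₁ b) ⟩
  y t + (x₁ (t ∸ b) + x₂ (t ∸ b ∸ a₁))     ∎
  where
  x₁ = gain (suc d′) m′
  x₂ = gain d′ (suc m′)
  y  = gain d m
  a₁ = ballSize (suc d′) m′
  a₂ = ballSize d′ (suc m′)
  b  = ballSize d m
gain-swap (suc d′) (suc m′) d m d′≤d m≤m′ t | inj₂ refl with m≤n⇒m<n∨m≡n d′≤d
... | inj₂ refl = ≤-refl
-- Now the right word splits into `y₁ y₂`, and `x` moves past `y₁`, then past `y₂`; the strict
-- inequality of the dimensions permits the second move.
gain-swap (suc d′) (suc m′) (suc d) m d′≤d m≤m′ t | inj₂ refl | inj₁ (s≤s d′<d) = begin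
  x t + (y₁ (t ∸ a) + y₂ (t ∸ a ∸ b₁))     ≡⟨ cong (λ z → x t + (y₁ (t ∸ a) + y₂ z)) (∸-swap t a b₁) ⟩
  x t + (y₁ (t ∸ a) + y₂ (t ∸ b₁ ∸ a))     ≡⟨ sym (+-assoc (x t) _ _) ⟩
  (x t + y₁ (t ∸ a)) + y₂ (t ∸ b₁ ∸ a)     ≤⟨ +-monoˡ-≤ _ (gain-swap (suc d′) (suc m′) (suc d) m′ d′≤d (n≤1+n m′) t) ⟩
  (y₁ t + x (t ∸ b₁)) + y₂ (t ∸ b₁ ∸ a)    ≡⟨ +-assoc (y₁ t) _ _ ⟩
  y₁ t + (x (t ∸ b₁) + y₂ (t ∸ b₁ ∸ a))    ≤⟨ +-monoʳ-≤ (y₁ t) (gain-swap (suc d′) (suc m′) d (suc m′) d′<d ≤-refl (t ∸ b₁)) ⟩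
  y₁ t + (y₂ (t ∸ b₁) + x (t ∸ b₁ ∸ b₂))   ≡⟨ sym (+-assoc (y₁ t) _ _) ⟩
  (y₁ t + y₂ (t ∸ b₁)) + x (t ∸ b₁ ∸ b₂)   ≡⟨ cong (λ z → (y₁ t + y₂ (t ∸ b₁)) + x z) (∸-+-assoc t b₁ b₂) ⟩
  (y₁ t + y₂ (t ∸ b₁)) + x (t ∸ (b₁ + b₂)) ∎
  where
  x  = gain (suc d′) (suc m′)
  y₁ = gain (suc d) m′
  y₂ = gain d (suc m′)
  a  = ballSize (suc d′) (suc m′)
  b₁ = ballSize (suc d) m′
  b₂ = ballSize d (suc m′)

-- For the word D d m repeated periodically, any s consecutive letters sum to at most
-- the first s letters.
gain-cyclic : ∀ d m r s → r ≤ ballSize d m → s ≤ ballSize d m →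
  gain d m (r + s) + gain d m (r + s ∸ ballSize d m) ≤ gain d m r + gain d m s
gain-cyclic zero m r s _ _ = z≤n
gain-cyclic (suc d) zero zero zero _ _ = z≤n
gain-cyclic (suc d) zero zero (suc zero) _ _ = ≤-reflexive (+-identityʳ _)
gain-cyclic (suc d) zero zero (suc (suc s)) _ (s≤s ())
gain-cyclic (suc d) zero (suc zero) zero _ _ = ≤-refl
gain-cyclic (suc d) zero (suc (suc r)) s (s≤s ()) _
gain-cyclic (suc d) zero (suc zero) (suc zero) _ _ = ≤-refl
gain-cyclic (suc d) zero (suc zero) (suc (suc s)) _ (s≤s ())
gain-cyclic (suc d) (suc m) r s r≤ s≤ = split (≤-total r b₁) (≤-total s b₁)
  where
  q₁ = gain (suc d) m
  q₂ = gain d (suc m)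
  q  = gain (suc d) (suc m)
  b₁ = ballSize (suc d) m
  b₂ = ballSize d (suc m)

  swap : ∀ t → q₂ t + q₁ (t ∸ b₂) ≤ q₁ t + q₂ (t ∸ b₁)
  swap = gain-swap d (suc m) (suc d) m (n≤1+n d) (n≤1+n m)

  -- The `t` letters read after the first block come from the second block and then from the first
  -- again. By `swap` they sum to at most `t` letters of the first block alone, and the induction
  -- hypothesis for that block applies.
  both-low : ∀ r s → r ≤ b₁ → s ≤ b₁ → q (r + s) + q (r + s ∸ (b₁ + b₂)) ≤ q r + q s
  both-low r s r≤b₁ s≤b₁ = begin
    (q₁ (r + s) + q₂ t) + q (r + s ∸ (b₁ + b₂))
      ≡⟨ cong (λ z → (q₁ (r + s) + q₂ t) + q z) (sym (∸-+-assoc (r + s) b₁ b₂)) ⟩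
    (q₁ (r + s) + q₂ t) + q (t ∸ b₂)
      ≡⟨ cong ((q₁ (r + s) + q₂ t) +_) (gain-below d m (≤-trans (m∸n≤m t b₂) t≤b₁)) ⟩
    (q₁ (r + s) + q₂ t) + q₁ (t ∸ b₂)  ≡⟨ +-assoc (q₁ (r + s)) _ _ ⟩
    q₁ (r + s) + (q₂ t + q₁ (t ∸ b₂))  ≤⟨ +-monoʳ-≤ (q₁ (r + s)) (swap t) ⟩
    q₁ (r + s) + (q₁ t + q₂ (t ∸ b₁))  ≡⟨ cong (λ z → q₁ (r + s) + (q₁ t + z)) (gain-∸≡0 d (suc m) t≤b₁) ⟩
    q₁ (r + s) + (q₁ t + 0)            ≡⟨ cong (q₁ (r + s) +_) (+-identityʳ _) ⟩
    q₁ (r + s) + q₁ t                  ≤⟨ gain-cyclic (suc d) m r s r≤b₁ s≤b₁ ⟩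
    q₁ r + q₁ s                        ≡⟨ sym (cong₂ _+_ (gain-below d m r≤b₁) (gain-below d m s≤b₁)) ⟩
    q r + q s ∎
    where
    t = r + s ∸ b₁
    t≤b₁ : t ≤ b₁
    t≤b₁ = ≤-trans (∸-monoˡ-≤ b₁ (+-mono-≤ r≤b₁ s≤b₁)) (≤-reflexive (m+n∸n≡m b₁ b₁))

  -- The last k entries of the second word are at most the last k entries of
  -- the first one, hence at most any k consecutive entries of the first one.
  tail-bound : ∀ w z k s → s + k ≡ b₂ → w + k ≡ b₁ → z + k ≤ b₁ →
    q₂ b₂ + q₁ z ≤ q₁ (z + k) + q₂ s
  tail-bound w z k s s+k w+k z+k≤b₁ = +-cancelˡ-≤ (q₁ b₁ + q₁ w) _ _ (begin
    (q₁ b₁ + q₁ w) + (q₂ b₂ + q₁ z)           ≡⟨ shuffle (q₁ b₁) (q₁ w) (q₂ b₂) (q₁ z) ⟩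
    (q₁ b₁ + q₁ z) + (q₂ b₂ + q₁ w)           ≤⟨ +-mono-≤ first second ⟩
    (q₁ w + q₁ (z + k)) + (q₁ b₁ + q₂ s)      ≡⟨ shuffle′ (q₁ w) (q₁ (z + k)) (q₁ b₁) (q₂ s) ⟩
    (q₁ b₁ + q₁ w) + (q₁ (z + k) + q₂ s)      ∎)
    where
    shuffle : ∀ a b c d → (a + b) + (c + d) ≡ (a + d) + (c + b)
    shuffle = solve-∀
    shuffle′ : ∀ a b c d → (a + b) + (c + d) ≡ (c + a) + (b + d)
    shuffle′ = solve-∀
    sum≡ : w + (z + k) ≡ b₁ + z
    sum≡ = trans (cong (w +_) (+-comm z k)) (trans (sym (+-assoc w k z)) (cong (_+ z) w+k))
    -- Read cyclically from position `w`, the next `z + k` letters are the last `k` and then the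
    -- first `z`.
    first : q₁ b₁ + q₁ z ≤ q₁ w + q₁ (z + k)
    first = begin
      q₁ b₁ + q₁ z                                 ≡⟨ cong₂ _+_ (sym (gain-saturates (suc d) m z)) (cong q₁ (sym (m+n∸m≡n b₁ z))) ⟩
      q₁ (b₁ + z) + q₁ (b₁ + z ∸ b₁)               ≡⟨ cong (λ x → q₁ x + q₁ (x ∸ b₁)) (sym sum≡) ⟩
      q₁ (w + (z + k)) + q₁ (w + (z + k) ∸ b₁)     ≤⟨ gain-cyclic (suc d) m w (z + k) (≤-trans (m≤m+n w k) (≤-reflexive w+k)) z+k≤b₁ ⟩
      q₁ w + q₁ (z + k) ∎
    b₁+s≡ : b₁ + s ≡ b₂ + w
    b₁+s≡ = trans (cong (_+ s) (sym w+k)) (trans (xy∙z≈zy∙x w k s) (cong (_+ w) s+k))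
    -- Both prefixes omit exactly the last `k` letters of the two concatenations, to which `swap`
    -- applies.
    second : q₂ b₂ + q₁ w ≤ q₁ b₁ + q₂ s
    second = begin
      q₂ b₂ + q₁ w                       ≡⟨ cong₂ _+_ (sym (gain-saturates d (suc m) w)) (cong q₁ (sym (m+n∸m≡n b₂ w))) ⟩
      q₂ (b₂ + w) + q₁ (b₂ + w ∸ b₂)     ≡⟨ cong (λ x → q₂ x + q₁ (x ∸ b₂)) (sym b₁+s≡) ⟩
      q₂ (b₁ + s) + q₁ (b₁ + s ∸ b₂)     ≤⟨ swap (b₁ + s) ⟩
      q₁ (b₁ + s) + q₂ (b₁ + s ∸ b₁)     ≡⟨ cong₂ _+_ (gain-saturates (suc d) m s) (cong q₂ (m+n∸m≡n b₁ s)) ⟩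
      q₁ b₁ + q₂ s ∎

  -- This concerns the `r` letters after position `s` in `D d (suc m) ++ D (suc d) m`. If they stay
  -- in the first of these words, `gain-cyclic` moves them to its start and `swap` compares the two
  -- words. Otherwise they are a tail of the first and `z` letters of the second, which is
  -- `tail-bound`.
  mixed-core : ∀ r s → r ≤ b₁ → s ≤ b₂ → q₂ (r + s) + q₁ (r + s ∸ b₂) ≤ q₁ r + q₂ s
  mixed-core r s r≤b₁ s≤b₂ with ≤-total (r + s) b₂
  ... | inj₁ r+s≤b₂ = begin
    q₂ (r + s) + q₁ (r + s ∸ b₂)  ≡⟨ cong (q₂ (r + s) +_) (gain-∸≡0 (suc d) m r+s≤b₂) ⟩
    q₂ (r + s) + 0                ≡⟨ cong (q₂ (r + s) +_) (sym (gain-∸≡0 d (suc m) r+s≤b₂)) ⟩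
    q₂ (r + s) + q₂ (r + s ∸ b₂)  ≤⟨ gain-cyclic d (suc m) r s (≤-trans (m≤m+n r s) r+s≤b₂) s≤b₂ ⟩
    q₂ r + q₂ s                   ≤⟨ +-monoˡ-≤ (q₂ s) (≤-trans (m≤m+n (q₂ r) _) (swap r)) ⟩
    (q₁ r + q₂ (r ∸ b₁)) + q₂ s   ≡⟨ cong (λ z → (q₁ r + z) + q₂ s) (gain-∸≡0 d (suc m) r≤b₁) ⟩
    (q₁ r + 0) + q₂ s             ≡⟨ cong (_+ q₂ s) (+-identityʳ (q₁ r)) ⟩
    q₁ r + q₂ s ∎
  ... | inj₂ b₂≤r+s = begin
    q₂ (r + s) + q₁ z   ≡⟨ cong (_+ q₁ z) (gain-full d (suc m) b₂≤r+s) ⟩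
    q₂ b₂ + q₁ z        ≤⟨ tail-bound (b₁ ∸ k) z k s (m+[n∸m]≡n s≤b₂) (m∸n+n≡m k≤b₁) (≤-trans (≤-reflexive z+k≡r) r≤b₁) ⟩
    q₁ (z + k) + q₂ s   ≡⟨ cong (λ x → q₁ x + q₂ s) z+k≡r ⟩
    q₁ r + q₂ s ∎
    where
    k = b₂ ∸ s
    z = r + s ∸ b₂
    z+k≡r : z + k ≡ r
    z+k≡r = +-cancelʳ-≡ s (z + k) r (trans (+-assoc z k s)
      (trans (cong (z +_) (m∸n+n≡m s≤b₂)) (m∸n+n≡m b₂≤r+s)))
    k≤b₁ : k ≤ b₁
    k≤b₁ = ≤-trans (m≤n+m k z) (≤-trans (≤-reflexive z+k≡r) r≤b₁)

  mixed : ∀ r s → r ≤ b₁ → s ≤ b₂ →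
    q (r + (b₁ + s)) + q (r + (b₁ + s) ∸ (b₁ + b₂)) ≤ q r + q (b₁ + s)
  mixed r s r≤b₁ s≤b₂ = begin
    q (r + (b₁ + s)) + q (r + (b₁ + s) ∸ (b₁ + b₂))  ≡⟨ cong (λ x → q x + q (x ∸ (b₁ + b₂))) move ⟩
    q (b₁ + (r + s)) + q (b₁ + (r + s) ∸ (b₁ + b₂))  ≡⟨ cong₂ _+_ (gain-above d m (r + s)) (cong q ([m+n]∸[m+o]≡n∸o b₁ (r + s) b₂)) ⟩
    (q₁ b₁ + q₂ (r + s)) + q (r + s ∸ b₂)            ≡⟨ cong ((q₁ b₁ + q₂ (r + s)) +_) (gain-below d m z≤b₁) ⟩
    (q₁ b₁ + q₂ (r + s)) + q₁ (r + s ∸ b₂)           ≡⟨ +-assoc (q₁ b₁) _ _ ⟩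
    q₁ b₁ + (q₂ (r + s) + q₁ (r + s ∸ b₂))           ≤⟨ +-monoʳ-≤ (q₁ b₁) (mixed-core r s r≤b₁ s≤b₂) ⟩
    q₁ b₁ + (q₁ r + q₂ s)                            ≡⟨ x∙yz≈y∙xz (q₁ b₁) (q₁ r) (q₂ s) ⟩
    q₁ r + (q₁ b₁ + q₂ s)                            ≡⟨ sym (cong₂ _+_ (gain-below d m r≤b₁) (gain-above d m s)) ⟩
    q r + q (b₁ + s) ∎
    where
    move : r + (b₁ + s) ≡ b₁ + (r + s)
    move = x∙yz≈y∙xz r b₁ s
    z≤b₁ : r + s ∸ b₂ ≤ b₁
    z≤b₁ = ≤-trans (∸-monoˡ-≤ b₂ (+-mono-≤ r≤b₁ s≤b₂)) (≤-reflexive (m+n∸n≡m b₁ b₂))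

  -- The left side reads the blocks in the order first, second, first, second. Exchanging the middle
  -- two by `swap` leaves two full first blocks and the induction hypothesis for the second.
  both-high : ∀ r s → r ≤ b₂ → s ≤ b₂ →
    q ((b₁ + r) + (b₁ + s)) + q ((b₁ + r) + (b₁ + s) ∸ (b₁ + b₂)) ≤ q (b₁ + r) + q (b₁ + s)
  both-high r s r≤b₂ s≤b₂ = begin
    q ((b₁ + r) + (b₁ + s)) + q ((b₁ + r) + (b₁ + s) ∸ (b₁ + b₂))
      ≡⟨ cong (λ x → q x + q (x ∸ (b₁ + b₂))) (double-shift b₁ r s) ⟩
    q (b₁ + t) + q (b₁ + t ∸ (b₁ + b₂))
      ≡⟨ cong₂ _+_ (gain-above d m t) (cong q ([m+n]∸[m+o]≡n∸o b₁ t b₂)) ⟩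
    (q₁ b₁ + q₂ t) + (q₁ (t ∸ b₂) + q₂ (t ∸ b₂ ∸ b₁))
      ≡⟨ cong (λ x → (q₁ b₁ + q₂ t) + (q₁ (t ∸ b₂) + q₂ x)) (trans (∸-swap t b₂ b₁) (cong (_∸ b₂) t∸b₁)) ⟩
    (q₁ b₁ + q₂ t) + (q₁ (t ∸ b₂) + q₂ (r + s ∸ b₂))
      ≡⟨ regroup (q₁ b₁) (q₂ t) (q₁ (t ∸ b₂)) _ ⟩
    q₁ b₁ + (q₂ t + q₁ (t ∸ b₂)) + q₂ (r + s ∸ b₂)
      ≤⟨ +-monoˡ-≤ _ (+-monoʳ-≤ (q₁ b₁) (swap t)) ⟩
    q₁ b₁ + (q₁ t + q₂ (t ∸ b₁)) + q₂ (r + s ∸ b₂)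
      ≡⟨ cong₂ (λ x y → q₁ b₁ + (x + q₂ y) + q₂ (r + s ∸ b₂)) (gain-saturates (suc d) m (r + s)) t∸b₁ ⟩
    q₁ b₁ + (q₁ b₁ + q₂ (r + s)) + q₂ (r + s ∸ b₂)
      ≡⟨ regroup′ (q₁ b₁) (q₂ (r + s)) _ ⟩
    (q₁ b₁ + q₁ b₁) + (q₂ (r + s) + q₂ (r + s ∸ b₂))
      ≤⟨ +-monoʳ-≤ (q₁ b₁ + q₁ b₁) (gain-cyclic d (suc m) r s r≤b₂ s≤b₂) ⟩
    (q₁ b₁ + q₁ b₁) + (q₂ r + q₂ s)
      ≡⟨ interchange (q₁ b₁) (q₁ b₁) (q₂ r) (q₂ s) ⟩
    (q₁ b₁ + q₂ r) + (q₁ b₁ + q₂ s)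
      ≡⟨ sym (cong₂ _+_ (gain-above d m r) (gain-above d m s)) ⟩
    q (b₁ + r) + q (b₁ + s) ∎
    where
    t = b₁ + (r + s)
    double-shift : ∀ a b c → (a + b) + (a + c) ≡ a + (a + (b + c))
    double-shift = solve-∀
    regroup : ∀ a b c d → (a + b) + (c + d) ≡ a + (b + c) + d
    regroup = solve-∀
    regroup′ : ∀ a b c → a + (a + b) + c ≡ (a + a) + (b + c)
    regroup′ = solve-∀
    t∸b₁ : t ∸ b₁ ≡ r + s
    t∸b₁ = m+n∸m≡n b₁ (r + s)

  excess : ∀ {x} → x ≤ b₁ + b₂ → x ∸ b₁ ≤ b₂
  excess x≤ = ≤-trans (∸-monoˡ-≤ b₁ x≤) (≤-reflexive (m+n∸m≡n b₁ b₂))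

  Goal : ℕ → ℕ → Set
  Goal r s = q (r + s) + q (r + s ∸ (b₁ + b₂)) ≤ q r + q s

  split : r ≤ b₁ ⊎ b₁ ≤ r → s ≤ b₁ ⊎ b₁ ≤ s → Goal r s
  split (inj₁ r≤b₁) (inj₁ s≤b₁) = both-low r s r≤b₁ s≤b₁
  split (inj₁ r≤b₁) (inj₂ b₁≤s) =
    subst (Goal r) (m+[n∸m]≡n b₁≤s) (mixed r (s ∸ b₁) r≤b₁ (excess s≤))
  -- The inequality is symmetric in `r` and `s`.
  split (inj₂ b₁≤r) (inj₁ s≤b₁) =
    subst₂ (λ x y → q x + q (x ∸ (b₁ + b₂)) ≤ y) (+-comm s r) (+-comm (q s) (q r))
      (subst (Goal s) (m+[n∸m]≡n b₁≤r) (mixed s (r ∸ b₁) s≤b₁ (excess r≤)))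
  split (inj₂ b₁≤r) (inj₂ b₁≤s) =
    subst₂ Goal (m+[n∸m]≡n b₁≤r) (m+[n∸m]≡n b₁≤s)
      (both-high (r ∸ b₁) (s ∸ b₁) (excess r≤) (excess s≤))

gain-subadditive : ∀ d m r s → gain d m (r + s) ≤ gain d m r + gain d m s
gain-subadditive d m r s with ≤-total r b | ≤-total s b
  where b = ballSize d m
... | inj₁ r≤b | inj₁ s≤b = ≤-trans (m≤m+n _ _) (gain-cyclic d m r s r≤b s≤b)
... | inj₂ b≤r | _ = ≤-trans (≤-reflexive (trans (gain-full d m (≤-trans b≤r (m≤m+n r s))) (sym (gain-full d m b≤r)))) (m≤m+n _ _)
... | inj₁ _ | inj₂ b≤s = ≤-trans (≤-reflexive (trans (gain-full d m (≤-trans b≤s (m≤n+m s r))) (sym (gain-full d m b≤s)))) (m≤n+m _ _)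

-- The inequality that combines the two slices

ballSize-mono-dim : ∀ d m → ballSize d m ≤ ballSize (suc d) m
ballSize-mono-dim zero    zero    = ≤-refl
ballSize-mono-dim (suc d) zero    = ≤-refl
ballSize-mono-dim d       (suc m) = m≤n+m (ballSize d (suc m)) (ballSize (suc d) m)

ballSize-1 : ∀ d → ballSize d 1 ≡ suc d
ballSize-1 zero    = refl
ballSize-1 (suc d) = cong suc (ballSize-1 d)

-- The neighbourhood of the ball of radius `m` is the ball of radius `m + 1`. The new vectors have
-- sum `m + 1`, so dropping the first coordinate identifies them with the ball of that radius one
-- dimension lower.
gain-total : ∀ d m → gain (suc d) m (ballSize (suc d) m) ≡ ballSize d (suc m)
gain-total d       zero    = sym (ballSize-1 d)
gain-total zero    (suc m) = trans (+-identityʳ _) (trans (gain-saturates 1 m 1) (gain-total zero m))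
gain-total (suc d) (suc m) =
  trans (gain-above (suc d) m (ballSize (suc d) (suc m)))
        (cong₂ _+_ (gain-total (suc d) m) (gain-total d (suc m)))

-- The word `D 1 m` is a 1 followed by zeros.
gain-1-suc : ∀ m n → gain 1 m (suc n) ≡ 1
gain-1-suc zero    n = refl
gain-1-suc (suc m) n = trans (+-identityʳ _) (gain-1-suc m n)

-- This is the case `b = 0` of `gain-split`, which relies on it. The two blocks are compared with
-- those one dimension lower; there the first block is no longer than before, so at least as many
-- letters are read from the second.
gain-dim-step : ∀ d m a → gain (suc d) m a ≤ gain d m a + a
gain-dim-step zero    m       zero    = ≤-reflexive (gain-0 1 m)
gain-dim-step zero    m       (suc a) = ≤-trans (≤-reflexive (gain-1-suc m a)) (s≤s z≤n)
gain-dim-step (suc d) zero    zero    = z≤n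
gain-dim-step (suc d) zero    (suc a) = ≤-trans (≤-reflexive (+-comm 1 (suc d))) (+-monoʳ-≤ (suc d) (s≤s z≤n))
gain-dim-step (suc d) (suc m) a with ≤-total a (ballSize (suc (suc d)) m)
... | inj₁ a≤b = begin
  gain (2 + d) (suc m) a       ≡⟨ gain-below (suc d) m a≤b ⟩
  gain (2 + d) m a             ≤⟨ gain-dim-step (suc d) m a ⟩
  gain (suc d) m a + a         ≤⟨ +-monoˡ-≤ a (m≤m+n (gain (suc d) m a) _) ⟩
  gain (suc d) (suc m) a + a   ∎
... | inj₂ b≤a = begin
  gain (2 + d) m a + gain (suc d) (suc m) a′             ≡⟨ cong (_+ gain (suc d) (suc m) a′) (gain-full (2 + d) m b≤a) ⟩
  gain (2 + d) m b + gain (suc d) (suc m) a′             ≤⟨ +-mono-≤ (gain-dim-step (suc d) m b) (gain-dim-step d (suc m) a′) ⟩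
  (gain (suc d) m b + b) + (gain d (suc m) a′ + a′)      ≤⟨ +-mono-≤ (+-monoˡ-≤ b (gain-mono (suc d) m b≤a)) (+-monoˡ-≤ a′ (gain-mono d (suc m) (∸-monoʳ-≤ a (ballSize-mono-dim (suc d) m)))) ⟩
  (gain (suc d) m a + b) + (gain d (suc m) a″ + a′)      ≡⟨ interchange (gain (suc d) m a) b (gain d (suc m) a″) a′ ⟩
  (gain (suc d) m a + gain d (suc m) a″) + (b + a′)      ≡⟨ cong (gain (suc d) (suc m) a +_) (m+[n∸m]≡n b≤a) ⟩
  gain (suc d) (suc m) a + a ∎
  where
  b = ballSize (suc (suc d)) m
  a′ = a ∸ b
  a″ = a ∸ ballSize (suc d) m

-- The main case of gain-split: the segment from b to a + b starts inside D (2 + d) m and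
-- ends n′ letters into D (suc d) (suc m).
gain-split-straddle : ∀ d m →
  (∀ x y → gain (suc d) (suc m) (x + y) ≤ gain d (suc m) x + (gain (suc d) (suc m) y ⊔ x)) →
  ∀ a b n′ → a + b ≡ ballSize (2 + d) m + n′ → b < ballSize (2 + d) m →
  gain (2 + d) (suc m) (a + b) ≤ gain (suc d) (suc m) a + (gain (2 + d) (suc m) b ⊔ a)
-- The first block has a single letter, which forces `b = 0`.
gain-split-straddle d zero ih a zero n′ n≡ b< = begin
  gain (2 + d) 1 (a + 0)      ≡⟨ cong (gain (2 + d) 1) (+-identityʳ a) ⟩
  gain (2 + d) 1 a            ≤⟨ gain-dim-step (suc d) 1 a ⟩
  gain (suc d) 1 a + a        ≤⟨ +-monoʳ-≤ (gain (suc d) 1 a) (m≤n⊔m (gain (2 + d) 1 0) a) ⟩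
  gain (suc d) 1 a + (gain (2 + d) 1 0 ⊔ a) ∎
gain-split-straddle d zero ih a (suc b) n′ n≡ (s≤s ())
gain-split-straddle d (suc m) ih a b n′ n≡ b<c₁ = split (≤-total b c₀) (≤-total a c₃)
  where
  q  = gain (2 + d) (2 + m)
  q₁ = gain (2 + d) (suc m)
  q₀ = gain (2 + d) m
  q₂ = gain (suc d) (2 + m)
  v  = gain (suc d) (suc m)
  w  = gain d (2 + m)
  c₀ = ballSize (2 + d) m
  c₃ = ballSize (suc d) (suc m)
  c₁ = c₀ + c₃

  Goal : Set
  Goal = q (a + b) ≤ q₂ a + (q b ⊔ a)

  q[a+b] : q (a + b) ≡ q₁ c₁ + q₂ n′
  q[a+b] = trans (cong q n≡) (gain-above (suc d) (suc m) n′)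

  q₁c₁-blocks : q₁ c₁ ≡ q₀ c₀ + v c₃
  q₁c₁-blocks = gain-above (suc d) m c₃

  -- By `gain-total` the left side is `ballSize (suc d) (2 + m)`; its recursive clause gives `c₃`
  -- plus a ball size that is again a total gain, `v c₃`.
  q₁c₁-total : q₁ c₁ ≡ v c₃ + c₃
  q₁c₁-total = trans (gain-total (suc d) (suc m)) (trans (+-comm c₃ _) (cong (_+ c₃) (sym (gain-total d (suc m)))))

  -- Here `a` is at least `c₃ + n′`, and the entry `a` of the maximum suffices.
  early : b ≤ c₀ → Goal
  early b≤c₀ = begin
    q (a + b)                        ≡⟨ trans q[a+b] (cong (_+ q₂ n′) q₁c₁-total) ⟩
    (v c₃ + c₃) + q₂ n′              ≤⟨ +-monoʳ-≤ (v c₃ + c₃) (gain-dim-step d (2 + m) n′) ⟩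
    (v c₃ + c₃) + (w n′ + n′)        ≡⟨ interchange (v c₃) c₃ (w n′) n′ ⟩
    (v c₃ + w n′) + (c₃ + n′)        ≡⟨ cong (_+ (c₃ + n′)) (sym (gain-above d (suc m) n′)) ⟩
    q₂ (c₃ + n′) + (c₃ + n′)         ≤⟨ +-mono-≤ (gain-mono (suc d) (2 + m) a≥) a≥ ⟩
    q₂ a + a                         ≤⟨ +-monoʳ-≤ (q₂ a) (m≤n⊔m (q b) a) ⟩
    q₂ a + (q b ⊔ a) ∎
    where
    a≥ : c₃ + n′ ≤ a
    a≥ = +-cancelʳ-≤ c₀ (c₃ + n′) a (begin
      c₃ + n′ + c₀    ≡⟨ xy∙z≈zx∙y c₃ n′ c₀ ⟩
      c₀ + c₃ + n′    ≡⟨ sym n≡ ⟩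
      a + b           ≤⟨ +-monoʳ-≤ a b≤c₀ ⟩
      a + c₀ ∎)

  late : ∀ r → c₀ + r ≡ b → a ≤ c₃ ⊎ c₃ ≤ a → Goal
  late r refl a?c₃ = finish a?c₃
    where
    r<c₃ : r < c₃
    r<c₃ = +-cancelˡ-< c₀ r c₃ b<c₁

    a+r≡ : a + r ≡ c₃ + n′
    a+r≡ = +-cancelˡ-≡ c₀ _ _ (trans (x∙yz≈y∙xz c₀ a r) (trans n≡ (+-assoc c₀ c₃ n′)))

    qb : q b ≡ q₀ c₀ + v r
    qb = trans (gain-below (suc d) (suc m) (<⇒≤ b<c₁)) (gain-above (suc d) m r)

    finish : a ≤ c₃ ⊎ c₃ ≤ a → Goal
    -- Since `a + r` exceeds the length `c₃` of `D (suc d) (suc m)` by `n′`, the sum `v c₃ + v n′`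
    -- is a wrapped prefix and `gain-cyclic` applies; the entry `q b` of the maximum suffices.
    finish (inj₁ a≤c₃) = begin
      q (a + b)                                ≡⟨ trans q[a+b] (cong₂ _+_ q₁c₁-blocks (gain-below d (suc m) n′≤c₃)) ⟩
      (q₀ c₀ + v c₃) + v n′                    ≡⟨ +-assoc (q₀ c₀) _ _ ⟩
      q₀ c₀ + (v c₃ + v n′)                    ≡⟨ cong₂ (λ x y → q₀ c₀ + (x + v y)) (sym (gain-saturates (suc d) (suc m) n′)) (sym (m+n∸m≡n c₃ n′)) ⟩
      q₀ c₀ + (v (c₃ + n′) + v (c₃ + n′ ∸ c₃)) ≡⟨ cong (λ x → q₀ c₀ + (v x + v (x ∸ c₃))) (sym a+r≡) ⟩
      q₀ c₀ + (v (a + r) + v (a + r ∸ c₃))     ≤⟨ +-monoʳ-≤ (q₀ c₀) (gain-cyclic (suc d) (suc m) a r a≤c₃ (<⇒≤ r<c₃)) ⟩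
      q₀ c₀ + (v a + v r)                      ≡⟨ x∙yz≈y∙xz (q₀ c₀) (v a) (v r) ⟩
      v a + (q₀ c₀ + v r)                      ≡⟨ cong₂ _+_ (sym (gain-below d (suc m) a≤c₃)) (sym qb) ⟩
      q₂ a + q b                               ≤⟨ +-monoʳ-≤ (q₂ a) (m≤m⊔n (q b) a) ⟩
      q₂ a + (q b ⊔ a) ∎
      where
      n′≤c₃ : n′ ≤ c₃
      n′≤c₃ = ≤-trans (+-cancelˡ-≤ c₃ n′ r (≤-trans (≤-reflexive (sym a+r≡)) (+-monoˡ-≤ r a≤c₃))) (<⇒≤ r<c₃)
    -- Removing a full block `c₃` from `a` leaves `n′ = t + r`, to which the induction hypothesis
    -- one dimension lower applies. Adding `q₁ c₁` turns both entries of its maximum into the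
    -- required ones, each increased by `v c₃`.
    finish (inj₂ c₃≤a) = begin
      q (a + b)                                   ≡⟨ q[a+b] ⟩
      q₁ c₁ + q₂ n′                               ≡⟨ cong (λ x → q₁ c₁ + q₂ x) n′≡ ⟩
      q₁ c₁ + q₂ (t + r)                          ≤⟨ +-monoʳ-≤ (q₁ c₁) (ih t r) ⟩
      q₁ c₁ + (w t + (q₂ r ⊔ t))                  ≡⟨ cong (λ x → q₁ c₁ + (w t + (x ⊔ t))) (gain-below d (suc m) (<⇒≤ r<c₃)) ⟩
      q₁ c₁ + (w t + (v r ⊔ t))                   ≡⟨ x∙yz≈y∙xz (q₁ c₁) (w t) _ ⟩
      w t + (q₁ c₁ + (v r ⊔ t))                   ≡⟨ cong (w t +_) (+-distribˡ-⊔ (q₁ c₁) (v r) t) ⟩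
      w t + ((q₁ c₁ + v r) ⊔ (q₁ c₁ + t))         ≡⟨ cong (w t +_) (cong₂ _⊔_ left right) ⟩
      w t + ((v c₃ + q b) ⊔ (v c₃ + a))           ≡⟨ cong (w t +_) (sym (+-distribˡ-⊔ (v c₃) (q b) a)) ⟩
      w t + (v c₃ + (q b ⊔ a))                    ≡⟨ x∙yz≈yx∙z (w t) (v c₃) _ ⟩
      (v c₃ + w t) + (q b ⊔ a)                    ≡⟨ cong (_+ (q b ⊔ a)) (sym (trans (cong q₂ (sym a≡)) (gain-above d (suc m) t))) ⟩
      q₂ a + (q b ⊔ a) ∎
      where
      t = a ∸ c₃
      a≡ : c₃ + t ≡ a
      a≡ = m+[n∸m]≡n c₃≤a
      n′≡ : n′ ≡ t + r
      n′≡ = +-cancelˡ-≡ c₃ _ _ (trans (sym a+r≡) (trans (cong (_+ r) (sym a≡)) (+-assoc c₃ t r)))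
      left : q₁ c₁ + v r ≡ v c₃ + q b
      left = trans (cong (_+ v r) q₁c₁-blocks) (trans (xy∙z≈y∙xz (q₀ c₀) (v c₃) (v r)) (cong (v c₃ +_) (sym qb)))
      right : q₁ c₁ + t ≡ v c₃ + a
      right = trans (cong (_+ t) q₁c₁-total) (trans (+-assoc (v c₃) c₃ t) (cong (v c₃ +_) a≡))

  split : b ≤ c₀ ⊎ c₀ ≤ b → a ≤ c₃ ⊎ c₃ ≤ a → Goal
  split (inj₁ b≤c₀) _    = early b≤c₀
  split (inj₂ c₀≤b) a?c₃ = late (b ∸ c₀) (m+[n∸m]≡n c₀≤b) a?c₃

-- What is needed to combine the elements with first coordinate zero (a of them) with the others (b of them).
gain-split : ∀ d m a b →
  gain (suc d) m (a + b) ≤ gain d m a + (gain (suc d) m b ⊔ a)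
gain-split zero m a zero = begin
  gain 1 m (a + 0)  ≡⟨ cong (gain 1 m) (+-identityʳ a) ⟩
  gain 1 m a        ≤⟨ gain-dim-step 0 m a ⟩
  a                 ≤⟨ m≤n⊔m (gain 1 m 0) a ⟩
  gain 1 m 0 ⊔ a ∎
gain-split zero m a (suc b) = begin
  gain 1 m (a + suc b)  ≡⟨ cong (gain 1 m) (+-suc a b) ⟩
  gain 1 m (suc (a + b)) ≡⟨ trans (gain-1-suc m (a + b)) (sym (gain-1-suc m b)) ⟩
  gain 1 m (suc b)      ≤⟨ m≤m⊔n _ a ⟩
  gain 1 m (suc b) ⊔ a ∎
gain-split (suc d) zero zero b = m≤m⊔n _ _
gain-split (suc d) zero (suc a) b = begin
  2 + d                                        ≡⟨ +-comm 1 (suc d) ⟩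
  suc d + 1                                    ≤⟨ +-monoʳ-≤ (suc d) (≤-trans (s≤s z≤n) (m≤n⊔m (gain (2 + d) 0 b) (suc a))) ⟩
  suc d + (gain (2 + d) 0 b ⊔ suc a) ∎
-- The cases locate the segment from `b` to `a + b`: inside the first block (recursion on `m`),
-- beyond it (subadditivity of the second block), or across its end.
gain-split (suc d) (suc m) a b = split (≤-total (a + b) c₁) (≤-<-connex c₁ b)
  where
  q  = gain (2 + d) (suc m)
  q₁ = gain (2 + d) m
  q₂ = gain (suc d) (suc m)
  v  = gain (suc d) m
  c₁ = ballSize (2 + d) m

  Goal : Set
  Goal = q (a + b) ≤ q₂ a + (q b ⊔ a)

  b≥ : c₁ ≤ b → Goal
  b≥ c₁≤b = begin
    q (a + b)                    ≡⟨ cong (λ x → q (a + x)) (sym b≡) ⟩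
    q (a + (c₁ + b′))            ≡⟨ cong q (x∙yz≈y∙xz a c₁ b′) ⟩
    q (c₁ + (a + b′))            ≡⟨ gain-above (suc d) m (a + b′) ⟩
    q₁ c₁ + q₂ (a + b′)          ≤⟨ +-monoʳ-≤ (q₁ c₁) (gain-subadditive (suc d) (suc m) a b′) ⟩
    q₁ c₁ + (q₂ a + q₂ b′)       ≡⟨ x∙yz≈y∙xz (q₁ c₁) (q₂ a) (q₂ b′) ⟩
    q₂ a + (q₁ c₁ + q₂ b′)       ≡⟨ cong (q₂ a +_) (sym (gain-above (suc d) m b′)) ⟩
    q₂ a + q (c₁ + b′)           ≡⟨ cong (λ x → q₂ a + q x) b≡ ⟩
    q₂ a + q b                   ≤⟨ +-monoʳ-≤ (q₂ a) (m≤m⊔n (q b) a) ⟩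
    q₂ a + (q b ⊔ a) ∎
    where
    b′ = b ∸ c₁
    b≡ : c₁ + b′ ≡ b
    b≡ = m+[n∸m]≡n c₁≤b

  low : a + b ≤ c₁ → Goal
  low a+b≤ = begin
    q (a + b)          ≡⟨ gain-below (suc d) m a+b≤ ⟩
    q₁ (a + b)         ≤⟨ gain-split (suc d) m a b ⟩
    v a + (q₁ b ⊔ a)   ≤⟨ +-mono-≤ (m≤m+n (v a) _) (⊔-monoˡ-≤ a (m≤m+n (q₁ b) _)) ⟩
    q₂ a + (q b ⊔ a) ∎

  split : a + b ≤ c₁ ⊎ c₁ ≤ a + b → c₁ ≤ b ⊎ b < c₁ → Goal
  split (inj₁ p) _ = low p
  split _ (inj₁ p) = b≥ p
  split (inj₂ p) (inj₂ q) = gain-split-straddle d m (gain-split d (suc m)) a b _ (sym (m+[n∸m]≡n p)) q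

-- Covers of finite subsets of ℕ^d

⊆⇒length≤ : ∀ {A : Set} {xs ys : List A} → Unique xs → xs ⊆ ys → length xs ≤ length ys
⊆⇒length≤ [] _ = z≤n
⊆⇒length≤ {xs = x ∷ xs} (x∉xs ∷ u) xs⊆ys with ∈-∃++ (xs⊆ys (here refl))
... | ys₁ , ys₂ , refl = begin
  suc (length xs)                ≤⟨ s≤s (⊆⇒length≤ u rest) ⟩
  suc (length (ys₁ ++ ys₂))      ≡⟨ cong suc (length-++ ys₁) ⟩
  suc (length ys₁ + length ys₂)  ≡⟨ sym (+-suc (length ys₁) _) ⟩
  length ys₁ + length (x ∷ ys₂)  ≡⟨ sym (length-++ ys₁) ⟩
  length (ys₁ ++ x ∷ ys₂) ∎
  where
  rest : xs ⊆ ys₁ ++ ys₂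
  rest z∈xs with ∈-++⁻ ys₁ (xs⊆ys (there z∈xs))
  ... | inj₁ z∈ys₁ = ∈-++⁺ˡ z∈ys₁
  ... | inj₂ (here refl) = ⊥-elim (All.lookup x∉xs z∈xs refl)
  ... | inj₂ (there z∈ys₂) = ∈-++⁺ʳ ys₁ z∈ys₂

zeroSlice : ∀ {d} → List (Vec ℕ (suc d)) → List (Vec ℕ d)
zeroSlice []                = []
zeroSlice ((zero  ∷ g) ∷ F) = g ∷ zeroSlice F
zeroSlice ((suc h ∷ g) ∷ F) = zeroSlice F

-- Positive heads are decremented, so that the translate of `F` by `e_1` appears in the slice as `F`
-- itself.
sucSlice : ∀ {d} → List (Vec ℕ (suc d)) → List (Vec ℕ (suc d))
sucSlice []                = []
sucSlice ((zero  ∷ g) ∷ F) = sucSlice F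
sucSlice ((suc h ∷ g) ∷ F) = (h ∷ g) ∷ sucSlice F

length-slices : ∀ {d} (F : List (Vec ℕ (suc d))) →
  length (zeroSlice F) + length (sucSlice F) ≡ length F
length-slices []                = refl
length-slices ((zero  ∷ g) ∷ F) = cong suc (length-slices F)
length-slices ((suc h ∷ g) ∷ F) =
  trans (+-suc (length (zeroSlice F)) _) (cong suc (length-slices F))

∈-zeroSlice⁺ : ∀ {d} {g : Vec ℕ d} {F} → (0 ∷ g) ∈ F → g ∈ zeroSlice F
∈-zeroSlice⁺ (here refl) = here refl
∈-zeroSlice⁺ {F = (zero  ∷ _) ∷ _} (there g∈) = there (∈-zeroSlice⁺ g∈)
∈-zeroSlice⁺ {F = (suc _ ∷ _) ∷ _} (there g∈) = ∈-zeroSlice⁺ g∈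

∈-zeroSlice⁻ : ∀ {d} {g : Vec ℕ d} {F} → g ∈ zeroSlice F → (0 ∷ g) ∈ F
∈-zeroSlice⁻ {F = (zero  ∷ _) ∷ _} (here refl) = here refl
∈-zeroSlice⁻ {F = (zero  ∷ _) ∷ _} (there g∈) = there (∈-zeroSlice⁻ g∈)
∈-zeroSlice⁻ {F = (suc _ ∷ _) ∷ _} g∈ = there (∈-zeroSlice⁻ g∈)

∈-sucSlice⁺ : ∀ {d h} {g : Vec ℕ d} {F} → (suc h ∷ g) ∈ F → (h ∷ g) ∈ sucSlice F
∈-sucSlice⁺ (here refl) = here refl
∈-sucSlice⁺ {F = (zero  ∷ _) ∷ _} (there g∈) = ∈-sucSlice⁺ g∈
∈-sucSlice⁺ {F = (suc _ ∷ _) ∷ _} (there g∈) = there (∈-sucSlice⁺ g∈)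

∈-sucSlice⁻ : ∀ {d h} {g : Vec ℕ d} {F} → (h ∷ g) ∈ sucSlice F → (suc h ∷ g) ∈ F
∈-sucSlice⁻ {F = (zero  ∷ _) ∷ _} g∈ = there (∈-sucSlice⁻ g∈)
∈-sucSlice⁻ {F = (suc _ ∷ _) ∷ _} (here refl) = here refl
∈-sucSlice⁻ {F = (suc _ ∷ _) ∷ _} (there g∈) = there (∈-sucSlice⁻ g∈)

zeroSlice-unique : ∀ {d} {F : List (Vec ℕ (suc d))} → Unique F → Unique (zeroSlice F)
zeroSlice-unique {F = []} _ = []
zeroSlice-unique {F = (zero  ∷ g) ∷ F} (g∉F ∷ u) =
  All.tabulate (λ { g∈ refl → All.lookup g∉F (∈-zeroSlice⁻ g∈) refl }) ∷ zeroSlice-unique u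
zeroSlice-unique {F = (suc _ ∷ _) ∷ F} (_ ∷ u) = zeroSlice-unique u

sucSlice-unique : ∀ {d} {F : List (Vec ℕ (suc d))} → Unique F → Unique (sucSlice F)
sucSlice-unique {F = []} _ = []
sucSlice-unique {F = (zero  ∷ _) ∷ F} (_ ∷ u) = sucSlice-unique u
sucSlice-unique {F = (suc h ∷ g) ∷ F} (g∉F ∷ u) =
  All.tabulate (λ { g∈ refl → All.lookup g∉F (∈-sucSlice⁻ g∈) refl }) ∷ sucSlice-unique u

-- Containment rather than equality passes to slices: the positive slice of a neighbourhood can be
-- larger than the neighbourhood of the positive slice.
record Covers {d} (N F : List (Vec ℕ d)) : Set where
  field
    base : F ⊆ N
    step : ∀ {g} → g ∈ F → ∀ i → (g [ i ]%= suc) ∈ N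
open Covers

covers-zeroSlice : ∀ {d} {N F : List (Vec ℕ (suc d))} → Covers N F → Covers (zeroSlice N) (zeroSlice F)
covers-zeroSlice cov .base g∈   = ∈-zeroSlice⁺ (base cov (∈-zeroSlice⁻ g∈))
covers-zeroSlice cov .step g∈ i = ∈-zeroSlice⁺ (step cov (∈-zeroSlice⁻ g∈) (suc i))

covers-sucSlice : ∀ {d} {N F : List (Vec ℕ (suc d))} → Covers N F → Covers (sucSlice N) (sucSlice F)
covers-sucSlice cov .base {_ ∷ _} g∈         = ∈-sucSlice⁺ (base cov (∈-sucSlice⁻ g∈))
covers-sucSlice cov .step {_ ∷ _} g∈ zero    = ∈-sucSlice⁺ (step cov (∈-sucSlice⁻ g∈) zero)
covers-sucSlice cov .step {_ ∷ _} g∈ (suc i) = ∈-sucSlice⁺ (step cov (∈-sucSlice⁻ g∈) (suc i))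

-- The bound is the measure for the recursion on `sucSlice`, which lowers heads but may keep the
-- length.
heads-bounded : ∀ {d} (F : List (Vec ℕ (suc d))) → ∃ λ k → ∀ {h g} → (h ∷ g) ∈ F → h < k
heads-bounded []            = 0 , λ ()
heads-bounded ((h ∷ g) ∷ F) with heads-bounded F
... | k , <k = suc h ⊔ k , λ
  { (here refl) → m≤m⊔n (suc h) k
  ; (there g∈)  → ≤-trans (<k g∈) (m≤n⊔m (suc h) k) }

-- Induction on the dimension treats the zero slice, and an inner induction on the bound of the
-- heads the positive one. The parameter `m` is not tied to the sums in `F`, so it may be chosen
-- from another family.
cover-length : ∀ d m {F N : List (Vec ℕ d)} → Unique F → Covers N F →
  length F + gain d m (length F) ≤ length N
cover-length zero m u cov = ≤-trans (≤-reflexive (+-identityʳ _)) (⊆⇒length≤ u (base cov))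
cover-length (suc d) m {F} u cov = bounded (proj₁ (heads-bounded F)) (proj₂ (heads-bounded F)) u cov
  where
  bounded : ∀ k {F N : List (Vec ℕ (suc d))} → (∀ {h g} → (h ∷ g) ∈ F → h < k) →
    Unique F → Covers N F → length F + gain (suc d) m (length F) ≤ length N
  bounded zero {[]} _ _ _ = ≤-trans (≤-reflexive (gain-0 (suc d) m)) z≤n
  bounded zero {(h ∷ g) ∷ F} <0 _ _ with () ← <0 (here refl)
  bounded (suc k) {F} {N} <k u cov = begin
    length F + q (length F)                ≡⟨ cong (λ x → x + q x) (sym (length-slices F)) ⟩
    (a + b) + q (a + b)                    ≤⟨ +-monoʳ-≤ (a + b) (gain-split d m a b) ⟩
    (a + b) + (q₀ a + (q b ⊔ a))           ≡⟨ interchange a b (q₀ a) (q b ⊔ a) ⟩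
    -- Both entries of the new maximum are lower bounds for the positive slice of `N`.
    (a + q₀ a) + (b + (q b ⊔ a))           ≡⟨ cong ((a + q₀ a) +_) (trans (+-distribˡ-⊔ b (q b) a) (cong ((b + q b) ⊔_) (+-comm b a))) ⟩
    (a + q₀ a) + ((b + q b) ⊔ (a + b))     ≤⟨ +-mono-≤ zeros (⊔-lub sucs shifted) ⟩
    length (zeroSlice N) + length (sucSlice N) ≡⟨ length-slices N ⟩
    length N ∎
    where
    q  = gain (suc d) m
    q₀ = gain d m
    a  = length (zeroSlice F)
    b  = length (sucSlice F)
    zeros : a + q₀ a ≤ length (zeroSlice N)
    zeros = cover-length d m (zeroSlice-unique u) (covers-zeroSlice cov)
    sucs : b + q b ≤ length (sucSlice N)
    sucs = bounded k (λ g∈ → s≤s⁻¹ (<k (∈-sucSlice⁻ g∈))) (sucSlice-unique u) (covers-sucSlice cov)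
    shift : F ⊆ sucSlice N
    shift {_ ∷ _} g∈ = ∈-sucSlice⁺ (step cov g∈ zero)
    shifted : a + b ≤ length (sucSlice N)
    shifted = ≤-trans (≤-reflexive (length-slices F)) (⊆⇒length≤ u shift)

-- Initial segments and the upper bound for their covers

-- The squashed order in terms of gap vectors, largest element first.
_⊏_ : ∀ {d} → Vec ℕ d → Vec ℕ d → Set
[]      ⊏ []      = ⊥
(x ∷ g) ⊏ (y ∷ h) = sum (x ∷ g) < sum (y ∷ h) ⊎ (sum (x ∷ g) ≡ sum (y ∷ h) × g ⊏ h)

-- Has sum m only if sum g ≤ m, because of the truncated subtraction.
ofSum : ∀ {d} → ℕ → Vec ℕ d → Vec ℕ (suc d)
ofSum m g = (m ∸ sum g) ∷ g

ball : ∀ d → ℕ → List (Vec ℕ d)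
ball zero    m       = [ [] ]
ball (suc d) zero    = [ Vec.replicate (suc d) 0 ]
ball (suc d) (suc m) = ball (suc d) m ++ map (ofSum (suc m)) (ball d (suc m))

length-ball : ∀ d m → length (ball d m) ≡ ballSize d m
length-ball zero    m       = refl
length-ball (suc d) zero    = refl
length-ball (suc d) (suc m) = trans (length-++ (ball (suc d) m))
  (cong₂ _+_ (length-ball (suc d) m) (trans (length-map _ (ball d (suc m))) (length-ball d (suc m))))

sum-ofSum : ∀ {d} m (g : Vec ℕ d) → sum g ≤ m → sum (ofSum m g) ≡ m
sum-ofSum m g = m∸n+n≡m

∷-ofSum : ∀ {d} {m} x (g : Vec ℕ d) → x + sum g ≡ m → x ∷ g ≡ ofSum m g
∷-ofSum x g refl = cong (_∷ g) (sym (m+n∸n≡m x (sum g)))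

∈-ofSum⁺ : ∀ {d m} x {g : Vec ℕ d} {G} → x + sum g ≡ m → g ∈ G → (x ∷ g) ∈ map (ofSum m) G
∈-ofSum⁺ {m = m} x {g} {G} ≡m g∈G =
  subst (_∈ map (ofSum m) G) (sym (∷-ofSum x g ≡m)) (∈-map⁺ (ofSum m) g∈G)

sum-0 : ∀ {d} (g : Vec ℕ d) → sum g ≤ 0 → g ≡ Vec.replicate d 0
sum-0 []         _  = refl
sum-0 (zero ∷ g) ≤0 = cong (0 ∷_) (sum-0 g ≤0)

∈-ball⁺ : ∀ {d m} (g : Vec ℕ d) → sum g ≤ m → g ∈ ball d m
∈-ball⁺ []      _ = here refl
∈-ball⁺ {m = zero} (x ∷ g) ≤0 = here (sum-0 (x ∷ g) ≤0)
∈-ball⁺ {suc d} {suc m} (x ∷ g) ≤m with m≤n⇒m<n∨m≡n ≤m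
... | inj₁ (s≤s ≤m′) = ∈-++⁺ˡ (∈-ball⁺ (x ∷ g) ≤m′)
... | inj₂ ≡m = ∈-++⁺ʳ (ball (suc d) m) (∈-ofSum⁺ x ≡m
  (∈-ball⁺ g (≤-trans (m≤n+m (sum g) x) ≤m)))

sum-replicate-0 : ∀ d → sum (Vec.replicate d 0) ≡ 0
sum-replicate-0 zero    = refl
sum-replicate-0 (suc d) = sum-replicate-0 d

∈-ball⁻ : ∀ {d} m {g : Vec ℕ d} → g ∈ ball d m → sum g ≤ m
∈-ball⁻ {zero}  m {[]} _ = z≤n
∈-ball⁻ {suc d} zero (here refl) = ≤-reflexive (sum-replicate-0 d)
∈-ball⁻ {suc d} (suc m) g∈ with ∈-++⁻ (ball (suc d) m) g∈
... | inj₁ g∈₁ = ≤-trans (∈-ball⁻ m g∈₁) (n≤1+n m)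
... | inj₂ g∈₂ with ∈-map⁻ (ofSum (suc m)) g∈₂
... | g′ , g′∈ , refl = ≤-reflexive (sum-ofSum (suc m) g′ (∈-ball⁻ (suc m) g′∈))

ofSum-injective : ∀ {d} m {g h : Vec ℕ d} → ofSum m g ≡ ofSum m h → g ≡ h
ofSum-injective m eq = proj₂ (∷-injective eq)

ball-++-unique : ∀ {d} m {G : List (Vec ℕ d)} → Unique (ball (suc d) m) → Unique G →
  (∀ {g} → g ∈ G → sum g ≤ suc m) → Unique (ball (suc d) m ++ map (ofSum (suc m)) G)
ball-++-unique m uB uG G≤ = Unique.++⁺ uB (Unique.map⁺ (ofSum-injective (suc m)) uG) disjoint
  where
  disjoint : ∀ {g} → (g ∈ ball _ m × g ∈ map (ofSum (suc m)) _) → ⊥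
  disjoint (g∈B , g∈G) with ∈-map⁻ (ofSum (suc m)) g∈G
  ... | g′ , g′∈ , refl =
    1+n≰n (≤-trans (≤-reflexive (sym (sum-ofSum (suc m) g′ (G≤ g′∈)))) (∈-ball⁻ m g∈B))

ball-unique : ∀ d m → Unique (ball d m)
ball-unique zero    m       = [] ∷ []
ball-unique (suc d) zero    = [] ∷ []
ball-unique (suc d) (suc m) =
  ball-++-unique m (ball-unique (suc d) m) (ball-unique d (suc m)) (∈-ball⁻ (suc m))

sum-%=suc : ∀ {d} (g : Vec ℕ d) i → sum (g [ i ]%= suc) ≡ suc (sum g)
sum-%=suc (x ∷ g) zero    = refl
sum-%=suc (x ∷ g) (suc i) = trans (cong (x +_) (sum-%=suc g i)) (+-suc x (sum g))

InitialIn : ∀ {d} → ℕ → List (Vec ℕ d) → Set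
InitialIn m F = ∀ {g h} → h ∈ F → sum g ≤ m → g ⊏ h → g ∈ F

-- If an initial `F` reaches sum `m + 1`, it contains the ball of radius `m`, and the tails `G` of
-- its top layer form an initial set one dimension lower. The ball of radius `m + 1`, together with
-- a cover of `G` lifted to sum `m + 2`, then covers `F`. If the top layer is empty, `m` decreases.
initial-cover : ∀ d m {F : List (Vec ℕ d)} → Unique F →
  (∀ {g} → g ∈ F → sum g ≤ m) → InitialIn m F →
  ∃ λ N → Covers N F × length N ≤ length F + gain d m (length F)
initial-cover zero m {F} u F≤ init = F , record { base = λ g∈ → g∈ ; step = λ _ () } , m≤m+n _ _
initial-cover (suc d) zero {[]} u F≤ init = [] , record { base = λ () ; step = λ () } , z≤n
-- Only the zero vector has sum 0, and the ball of radius 1 consists of it and its `suc d` steps.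
initial-cover (suc d) zero {g₀ ∷ F} u F≤ init = ball (suc d) 1 , cov , size
  where
  cov : Covers (ball (suc d) 1) (g₀ ∷ F)
  cov .base g∈       = ∈-ball⁺ {m = 1} _ (≤-trans (F≤ g∈) z≤n)
  cov .step {g} g∈ i = ∈-ball⁺ {m = 1} _ (≤-trans (≤-reflexive (sum-%=suc g i)) (s≤s (F≤ g∈)))
  size : length (ball (suc d) 1) ≤ suc (length F) + suc d
  size = begin
    length (ball (suc d) 1)  ≡⟨ trans (length-ball (suc d) 1) (ballSize-1 (suc d)) ⟩
    suc (suc d)              ≤⟨ s≤s (m≤n+m (suc d) (length F)) ⟩
    suc (length F) + suc d ∎
initial-cover (suc d) (suc m) {F} u F≤ init = dispatch (filter top? (ball d (suc m))) refl
  where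
  open import Data.List.Membership.DecPropositional (≡-dec {n = suc d} _≟_) using (_∈?_)

  top? : (g : Vec ℕ d) → Dec (ofSum (suc m) g ∈ F)
  top? g = ofSum (suc m) g ∈? F

  G = filter top? (ball d (suc m))

  uG : Unique G
  uG = Unique.filter⁺ top? (ball-unique d (suc m))

  ∈G⁺ : ∀ x g → (x ∷ g) ∈ F → x + sum g ≡ suc m → g ∈ G
  ∈G⁺ x g xg∈F ≡m = ∈-filter⁺ top? (∈-ball⁺ g (≤-trans (m≤n+m (sum g) x) (≤-reflexive ≡m)))
    (subst (_∈ F) (∷-ofSum x g ≡m) xg∈F)

  ∈G⁻ : ∀ {g} → g ∈ G → sum g ≤ suc m × ofSum (suc m) g ∈ F
  ∈G⁻ g∈ with ∈-filter⁻ top? {xs = ball d (suc m)} g∈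
  ... | g∈B , g∈F = ∈-ball⁻ (suc m) g∈B , g∈F

  initG : InitialIn (suc m) G
  initG {g} {h} h∈G g≤ g⊏h with ∈G⁻ h∈G
  ... | h≤ , h∈F = ∈G⁺ (suc m ∸ sum g) g
    (init h∈F (≤-reflexive (sum-ofSum (suc m) g g≤))
      (inj₂ (trans (sum-ofSum (suc m) g g≤) (sym (sum-ofSum (suc m) h h≤)) , g⊏h)))
    (sum-ofSum (suc m) g g≤)

  dispatch : ∀ G′ → G′ ≡ G → ∃ λ N → Covers N F × length N ≤ length F + gain (suc d) (suc m) (length F)
  dispatch [] []≡G with initial-cover (suc d) m u F≤m (λ h∈ g≤ → init h∈ (≤-trans g≤ (n≤1+n m)))
    where
    F≤m : ∀ {g} → g ∈ F → sum g ≤ m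
    F≤m {x ∷ g} g∈ with m≤n⇒m<n∨m≡n (F≤ g∈)
    ... | inj₁ (s≤s g≤m) = g≤m
    ... | inj₂ ≡m with () ← subst (g ∈_) (sym []≡G) (∈G⁺ x g g∈ ≡m)
  ... | N , cov , size = N , cov , ≤-trans size (+-monoʳ-≤ (length F) (m≤m+n _ _))
  dispatch (g₀ ∷ G₀) ≡G with initial-cover d (suc m) uG (λ g∈ → proj₁ (∈G⁻ g∈)) initG
  ... | N , covN , sizeN = B ++ map (ofSum (2 + m)) N , cov , size
    where
    B = ball (suc d) (suc m)
    c = ballSize (suc d) m
    n′ = length G

    below : ball (suc d) m ++ map (ofSum (suc m)) G ⊆ F
    below {x ∷ g} g∈ with ∈-++⁻ (ball (suc d) m) g∈
    -- The tail `g₀` yields an element of `F` with sum `m + 1`, which every vector of smaller sum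
    -- precedes.
    ... | inj₁ g∈B with ∈G⁻ (subst (g₀ ∈_) ≡G (here refl))
    ...   | g₀≤ , g₀∈F = init g₀∈F (≤-trans (∈-ball⁻ m g∈B) (n≤1+n m))
      (inj₁ (≤-trans (s≤s (∈-ball⁻ m g∈B)) (≤-reflexive (sym (sum-ofSum (suc m) g₀ g₀≤)))))
    below {x ∷ g} g∈ | inj₂ g∈G with ∈-map⁻ (ofSum (suc m)) g∈G
    ...   | g′ , g′∈ , refl = proj₂ (∈G⁻ g′∈)

    c+n′≤ : c + n′ ≤ length F
    c+n′≤ = begin
      c + n′                                                   ≡⟨ sym (cong₂ _+_ (length-ball (suc d) m) (length-map (ofSum (suc m)) G)) ⟩
      length (ball (suc d) m) + length (map (ofSum (suc m)) G) ≡⟨ sym (length-++ (ball (suc d) m)) ⟩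
      length (ball (suc d) m ++ map (ofSum (suc m)) G)         ≤⟨ ⊆⇒length≤ (ball-++-unique m (ball-unique (suc d) m) uG (λ g∈ → proj₁ (∈G⁻ g∈))) below ⟩
      length F ∎

    size : length (B ++ map (ofSum (2 + m)) N) ≤ length F + gain (suc d) (suc m) (length F)
    size = begin
      length (B ++ map (ofSum (2 + m)) N)       ≡⟨ length-++ B ⟩
      length B + length (map (ofSum (2 + m)) N) ≡⟨ cong₂ _+_ (length-ball (suc d) (suc m)) (length-map _ N) ⟩
      (c + ballSize d (suc m)) + length N       ≤⟨ +-monoʳ-≤ (c + ballSize d (suc m)) sizeN ⟩
      (c + ballSize d (suc m)) + (n′ + gain d (suc m) n′)
        ≡⟨ interchange c (ballSize d (suc m)) n′ (gain d (suc m) n′) ⟩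
      (c + n′) + (ballSize d (suc m) + gain d (suc m) n′)
        -- The layer of sum `m + 1` in `B` is exactly the gain of the full ball of radius `m`.
        ≡⟨ cong (λ x → (c + n′) + (x + gain d (suc m) n′)) (sym (gain-total d m)) ⟩
      (c + n′) + (gain (suc d) m c + gain d (suc m) n′)
        ≡⟨ cong ((c + n′) +_) (sym (gain-above d m n′)) ⟩
      (c + n′) + gain (suc d) (suc m) (c + n′)
        ≤⟨ +-mono-≤ c+n′≤ (gain-mono (suc d) (suc m) c+n′≤) ⟩
      length F + gain (suc d) (suc m) (length F) ∎

    in-level : ∀ x (g : Vec ℕ d) → g ∈ N → x + sum g ≡ 2 + m → (x ∷ g) ∈ B ++ map (ofSum (2 + m)) N
    in-level x g g∈ ≡m = ∈-++⁺ʳ B (∈-ofSum⁺ x ≡m g∈)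

    cov : Covers (B ++ map (ofSum (2 + m)) N) F
    cov .base g∈ = ∈-++⁺ˡ (∈-ball⁺ _ (F≤ g∈))
    cov .step {x ∷ g} g∈ i with m≤n⇒m<n∨m≡n (F≤ g∈)
    ... | inj₁ g<m = ∈-++⁺ˡ (∈-ball⁺ _ (≤-trans (≤-reflexive (sum-%=suc (x ∷ g) i)) g<m))
    -- Raising the head keeps the tail, while raising a later coordinate is a step of the tail; `N`
    -- contains both tails.
    cov .step {x ∷ g} g∈ zero    | inj₂ ≡m = in-level (suc x) g (base covN (∈G⁺ x g g∈ ≡m)) (cong suc ≡m)
    cov .step {x ∷ g} g∈ (suc i) | inj₂ ≡m =
      in-level x (g [ i ]%= suc) (step covN (∈G⁺ x g g∈ ≡m) i)
        (trans (sum-%=suc (x ∷ g) (suc i)) (cong suc ≡m))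

-- d-sets and their gap vectors

lookup-∷ʳ-last : ∀ {d} (u : Vec ℕ d) t → lookup (u ∷ʳ t) (fromℕ d) ≡ t
lookup-∷ʳ-last []      t = refl
lookup-∷ʳ-last (_ ∷ u) t = lookup-∷ʳ-last u t

lookup-∷ʳ-init : ∀ {d} (u : Vec ℕ d) t i → lookup (u ∷ʳ t) (inject₁ i) ≡ lookup u i
lookup-∷ʳ-init (_ ∷ u) t zero    = refl
lookup-∷ʳ-init (_ ∷ u) t (suc i) = lookup-∷ʳ-init u t i

∈-∷ʳ-init : ∀ {d x t} {u : Vec ℕ d} → x V.∈ u → x V.∈ (u ∷ʳ t)
∈-∷ʳ-init (VAny.here x≡)  = VAny.here x≡
∈-∷ʳ-init (VAny.there x∈) = VAny.there (∈-∷ʳ-init x∈)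

∈-∷ʳ-last : ∀ {d t} (u : Vec ℕ d) → t V.∈ (u ∷ʳ t)
∈-∷ʳ-last []      = VAny.here refl
∈-∷ʳ-last (_ ∷ u) = VAny.there (∈-∷ʳ-last u)

∈-∷ʳ⁻ : ∀ {d x t} (u : Vec ℕ d) → x V.∈ (u ∷ʳ t) → x V.∈ u ⊎ x ≡ t
∈-∷ʳ⁻ []      (VAny.here x≡) = inj₂ x≡
∈-∷ʳ⁻ (_ ∷ u) (VAny.here x≡) = inj₁ (VAny.here x≡)
∈-∷ʳ⁻ (_ ∷ u) (VAny.there x∈) with ∈-∷ʳ⁻ u x∈
... | inj₁ x∈u = inj₁ (VAny.there x∈u)
... | inj₂ x≡  = inj₂ x≡

IsDSet-∷ʳ⁺ : ∀ {d} (u : Vec ℕ d) {t} → IsDSet u → 1 ≤ t → (∀ i → lookup u i < t) → IsDSet (u ∷ʳ t)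
IsDSet-∷ʳ⁺ {d} u {t} (pos , inc) 1≤t <t = pos′ , inc′
  where
  pos′ : ∀ i → 1 ≤ lookup (u ∷ʳ t) i
  pos′ i with view i
  ... | ‵fromℕ     = subst (1 ≤_) (sym (lookup-∷ʳ-last u t)) 1≤t
  ... | ‵inject₁ j = subst (1 ≤_) (sym (lookup-∷ʳ-init u t j)) (pos j)
  inc′ : ∀ i j → toℕ i < toℕ j → lookup (u ∷ʳ t) i < lookup (u ∷ʳ t) j
  inc′ i j i<j with view i | view j
  ... | ‵fromℕ     | _ = ⊥-elim (<⇒≱ i<j (≤-trans (s≤s⁻¹ (toℕ<n j)) (≤-reflexive (sym (toℕ-fromℕ d)))))
  ... | ‵inject₁ k | ‵fromℕ = subst₂ _<_ (sym (lookup-∷ʳ-init u t k)) (sym (lookup-∷ʳ-last u t)) (<t k)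
  ... | ‵inject₁ k | ‵inject₁ l = subst₂ _<_ (sym (lookup-∷ʳ-init u t k)) (sym (lookup-∷ʳ-init u t l))
        (inc k l (subst₂ _<_ (toℕ-inject₁ k) (toℕ-inject₁ l) i<j))

IsDSet-∷ʳ⁻ : ∀ {d} (u : Vec ℕ d) {t} → IsDSet (u ∷ʳ t) → IsDSet u × 1 ≤ t × (∀ i → lookup u i < t)
IsDSet-∷ʳ⁻ {d} u {t} (pos , inc) =
  ((λ i → subst (1 ≤_) (lookup-∷ʳ-init u t i) (pos (inject₁ i))) ,
   (λ i j i<j → subst₂ _<_ (lookup-∷ʳ-init u t i) (lookup-∷ʳ-init u t j)
     (inc (inject₁ i) (inject₁ j) (subst₂ _<_ (sym (toℕ-inject₁ i)) (sym (toℕ-inject₁ j)) i<j)))) ,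
  subst (1 ≤_) (lookup-∷ʳ-last u t) (pos (fromℕ d)) ,
  λ i → subst₂ _<_ (lookup-∷ʳ-init u t i) (lookup-∷ʳ-last u t)
     (inc (inject₁ i) (fromℕ d) (subst₂ _<_ (sym (toℕ-inject₁ i)) (sym (toℕ-fromℕ d)) (toℕ<n i)))

-- The vector (g_d , … , g_1) encodes u with u_i = g_1 + … + g_i + i, so that top is u_d.
top : ∀ {d} → Vec ℕ d → ℕ
top {d} g = sum g + d

toSet : ∀ {d} → Vec ℕ d → Vec ℕ d
toSet []      = []
toSet (x ∷ g) = toSet g ∷ʳ top (x ∷ g)

top< : ∀ {d} x (g : Vec ℕ d) → top g < top (x ∷ g)
top< {d} x g = ≤-trans (≤-reflexive (sym (+-suc (sum g) d))) (+-monoˡ-≤ (suc d) (m≤n+m (sum g) x))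

∈-toSet⇒≤top : ∀ {d y} (g : Vec ℕ d) → y V.∈ toSet g → y ≤ top g
∈-toSet⇒≤top (x ∷ g) y∈ with ∈-∷ʳ⁻ (toSet g) y∈
... | inj₁ y∈g  = ≤-trans (∈-toSet⇒≤top g y∈g) (<⇒≤ (top< x g))
... | inj₂ refl = ≤-refl

lookup-toSet≤top : ∀ {d} (g : Vec ℕ d) i → lookup (toSet g) i ≤ top g
lookup-toSet≤top (x ∷ g) i with view i
... | ‵fromℕ     = ≤-reflexive (lookup-∷ʳ-last (toSet g) _)
... | ‵inject₁ j = ≤-trans (≤-reflexive (lookup-∷ʳ-init (toSet g) _ j))
                     (≤-trans (lookup-toSet≤top g j) (<⇒≤ (top< x g)))

toSet-IsDSet : ∀ {d} (g : Vec ℕ d) → IsDSet (toSet g)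
toSet-IsDSet []      = (λ ()) , λ ()
toSet-IsDSet (x ∷ g) = IsDSet-∷ʳ⁺ (toSet g) (toSet-IsDSet g) (≤-trans (s≤s z≤n) (top< x g))
  (λ i → ≤-trans (s≤s (lookup-toSet≤top g i)) (top< x g))

toSet-surjective : ∀ {d} (u : Vec ℕ d) → IsDSet u → ∃ λ g → toSet g ≡ u
toSet-surjective {zero}  []  _ = [] , refl
toSet-surjective {suc d} u isD with Vec.initLast u
... | v , t , refl with IsDSet-∷ʳ⁻ v isD
... | isDv , 1≤t , <t with toSet-surjective v isDv
-- The new gap counts the integers strictly between the previous largest element and `t`.
... | g , refl = (t ∸ suc (top g)) ∷ g , cong (toSet g ∷ʳ_) top≡t
  where
  top<t : ∀ {d} (g : Vec ℕ d) → (∀ i → lookup (toSet g) i < t) → top g < t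
  top<t []      _  = 1≤t
  top<t (x ∷ g) <t = subst (_< t) (lookup-∷ʳ-last (toSet g) _) (<t (fromℕ _))
  top≡t : t ∸ suc (top g) + sum g + suc d ≡ t
  top≡t = trans (+-assoc (t ∸ suc (top g)) (sum g) (suc d))
    (trans (cong (t ∸ suc (top g) +_) (+-suc (sum g) d)) (m∸n+n≡m (top<t g <t)))

toSet-injective : ∀ {d} {g h : Vec ℕ d} → toSet g ≡ toSet h → g ≡ h
toSet-injective {g = []} {[]} _ = refl
toSet-injective {suc d} {x ∷ g} {y ∷ h} eq with ∷ʳ-injective (toSet g) (toSet h) eq
... | eq′ , top≡ with toSet-injective {g = g} {h} eq′
... | refl = cong (_∷ g) (+-cancelʳ-≡ (sum g) x y (+-cancelʳ-≡ (suc d) _ _ top≡))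

-- If the tops differ, that of `h` lies above the witness `z` and would have to belong to `toSet g`,
-- whose elements are all smaller. If they agree, `z` is not the top, and the common largest element
-- is removed.
⊏⇒⊀ : ∀ {d} {g h : Vec ℕ d} → g ⊏ h → ¬ (toSet h ≺ toSet g)
⊏⇒⊀ {suc d} {x ∷ g} {y ∷ h} (inj₁ s<) (z , z∈g , z∉h , above) =
  <⇒≱ t<t (∈-toSet⇒≤top (x ∷ g) (Equivalence.to (above (top (y ∷ h)) (≤-trans (s≤s (∈-toSet⇒≤top (x ∷ g) z∈g)) t<t)) (∈-∷ʳ-last (toSet h))))
  where
  t<t : top (x ∷ g) < top (y ∷ h)
  t<t = +-monoˡ-< (suc d) s<
⊏⇒⊀ {suc d} {x ∷ g} {y ∷ h} (inj₂ (s≡ , g⊏h)) (z , z∈g , z∉h , above) with ∈-∷ʳ⁻ (toSet g) z∈g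
... | inj₂ refl = z∉h (subst (V._∈ toSet (y ∷ h)) (sym t≡) (∈-∷ʳ-last (toSet h)))
  where
  t≡ : top (x ∷ g) ≡ top (y ∷ h)
  t≡ = cong (_+ suc d) s≡
... | inj₁ z∈g′ = ⊏⇒⊀ g⊏h (z , z∈g′ , z∉h ∘ ∈-∷ʳ-init , λ w z<w → mk⇔ (fwd w z<w) (bwd w z<w))
  where
  t≡ : top (x ∷ g) ≡ top (y ∷ h)
  t≡ = cong (_+ suc d) s≡
  fwd : ∀ w → z < w → w V.∈ toSet h → w V.∈ toSet g
  fwd w z<w w∈ with ∈-∷ʳ⁻ (toSet g) (Equivalence.to (above w z<w) (∈-∷ʳ-init w∈))
  ... | inj₁ w∈g = w∈g
  ... | inj₂ w≡  = ⊥-elim (<⇒≱ (top< y h) (≤-trans (≤-reflexive (trans (sym t≡) (sym w≡))) (∈-toSet⇒≤top h w∈)))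
  bwd : ∀ w → z < w → w V.∈ toSet g → w V.∈ toSet h
  bwd w z<w w∈ with ∈-∷ʳ⁻ (toSet h) (Equivalence.from (above w z<w) (∈-∷ʳ-init w∈))
  ... | inj₁ w∈h = w∈h
  ... | inj₂ w≡  = ⊥-elim (<⇒≱ (top< x g) (≤-trans (≤-reflexive (trans t≡ (sym w≡))) (∈-toSet⇒≤top g w∈)))

-- Maps of `Inc_1` as unit steps of gap vectors

inc1-≥ : ∀ {π} → IsInc1 π → ∀ j → 1 ≤ j → j ≤ π j
inc1-≥ isπ (suc zero)    _ = proj₁ (isπ 1 ≤-refl)
inc1-≥ isπ (suc (suc j)) _ =
  ≤-trans (s≤s (inc1-≥ isπ (suc j) (s≤s z≤n))) (proj₁ (proj₂ (isπ (suc j) (s≤s z≤n))))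

-- Descending from a fixed point `t + 1`, strict growth forces `π t ≤ t`, and `inc1-≥` gives
-- equality.
inc1-fixed-below : ∀ {π} → IsInc1 π → ∀ t → π t ≡ t → ∀ j → 1 ≤ j → j ≤ t → π j ≡ j
inc1-fixed-below isπ zero    πt≡ j 1≤j j≤t = ⊥-elim (<⇒≱ 1≤j j≤t)
inc1-fixed-below {π} isπ (suc t) πt≡ j 1≤j j≤t with m≤n⇒m<n∨m≡n j≤t
... | inj₂ refl = πt≡
... | inj₁ (s≤s j≤t′) = inc1-fixed-below isπ t (≤-antisym πt≤t (inc1-≥ isπ t 1≤t)) j 1≤j j≤t′
  where
  1≤t : 1 ≤ t
  1≤t = ≤-trans 1≤j j≤t′
  πt≤t : π t ≤ t
  πt≤t = s≤s⁻¹ (≤-trans (proj₁ (proj₂ (isπ t 1≤t))) (≤-reflexive πt≡))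

map-toSet-fixed : ∀ {d} {π} (g : Vec ℕ d) → (∀ j → 1 ≤ j → j ≤ top g → π j ≡ j) →
  Vec.map π (toSet g) ≡ toSet g
map-toSet-fixed []      _ = refl
map-toSet-fixed {π = π} (x ∷ g) fix = trans (map-∷ʳ π (top (x ∷ g)) (toSet g))
  (cong₂ _∷ʳ_ (map-toSet-fixed g (λ j 1≤j j≤ → fix j 1≤j (≤-trans j≤ (<⇒≤ (top< x g)))))
              (fix _ (≤-trans (s≤s z≤n) (top< x g)) ≤-refl))

toSet-[suc]%=suc : ∀ {d} x (g : Vec ℕ d) i → toSet ((x ∷ g) [ suc i ]%= suc) ≡ toSet (g [ i ]%= suc) ∷ʳ suc (top (x ∷ g))
toSet-[suc]%=suc {d} x g i = cong (λ s → toSet (g [ i ]%= suc) ∷ʳ (s + suc d)) (sum-%=suc (x ∷ g) (suc i))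

-- If the largest element is fixed, so are all others. Otherwise it moves by one: when the rest is
-- fixed, its own gap grows, and when the rest moves by raising gap `i`, its own gap is unchanged
-- and the index becomes `suc i`.
inc1⇒step : ∀ {d} {π} (g : Vec ℕ d) → IsInc1 π →
  Vec.map π (toSet g) ≡ toSet g ⊎ ∃ λ i → Vec.map π (toSet g) ≡ toSet (g [ i ]%= suc)
inc1⇒step [] _ = inj₁ refl
inc1⇒step {π = π} (x ∷ g) isπ with m≤n⇒m<n∨m≡n (inc1-≥ isπ t 1≤t)
  where
  t = top (x ∷ g)
  1≤t : 1 ≤ t
  1≤t = ≤-trans (s≤s z≤n) (top< x g)
... | inj₂ t≡πt = inj₁ (map-toSet-fixed (x ∷ g) (inc1-fixed-below isπ _ (sym t≡πt)))
... | inj₁ t<πt with inc1⇒step g isπ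
...   | inj₁ fixed = inj₂ (zero , trans (map-∷ʳ π _ (toSet g)) (cong₂ _∷ʳ_ fixed πt≡))
  where
  πt≡ : π (top (x ∷ g)) ≡ suc (top (x ∷ g))
  πt≡ = ≤-antisym (proj₂ (proj₂ (isπ (top (x ∷ g)) (≤-trans (s≤s z≤n) (top< x g))))) t<πt
...   | inj₂ (i , moved) = inj₂ (suc i , trans (map-∷ʳ π _ (toSet g)) (trans (cong₂ _∷ʳ_ moved πt≡) (sym (toSet-[suc]%=suc x g i))))
  where
  πt≡ : π (top (x ∷ g)) ≡ suc (top (x ∷ g))
  πt≡ = ≤-antisym (proj₂ (proj₂ (isπ (top (x ∷ g)) (≤-trans (s≤s z≤n) (top< x g))))) t<πt

-- These maps suffice to realise every step and, with a threshold above the largest element, the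
-- identity on a given set.
shiftFrom : ℕ → ℕ → ℕ
shiftFrom k j with k ≤? j
... | yes _ = suc j
... | no  _ = j

shiftFrom-≥ : ∀ {k j} → k ≤ j → shiftFrom k j ≡ suc j
shiftFrom-≥ {k} {j} k≤j with k ≤? j
... | yes _  = refl
... | no k≰j = ⊥-elim (k≰j k≤j)

shiftFrom-< : ∀ {k j} → j < k → shiftFrom k j ≡ j
shiftFrom-< {k} {j} j<k with k ≤? j
... | yes k≤j = ⊥-elim (<⇒≱ j<k k≤j)
... | no _    = refl

shiftFrom-inc1 : ∀ k → IsInc1 (shiftFrom k)
shiftFrom-inc1 k j 1≤j with k ≤? j | k ≤? suc j
... | yes k≤j | yes _  = s≤s z≤n , ≤-refl , ≤-refl
... | yes k≤j | no k≰  = ⊥-elim (k≰ (≤-trans k≤j (n≤1+n j)))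
... | no _    | yes _  = 1≤j , n≤1+n (suc j) , n≤1+n j
... | no _    | no _   = 1≤j , ≤-refl , n≤1+n j

-- The threshold `k` is the element whose gap is raised. The bound `k ≤ top g` ensures in the
-- recursion that the larger elements move as well.
step⇒shift : ∀ {d} (g : Vec ℕ d) i →
  ∃ λ k → k ≤ top g × Vec.map (shiftFrom k) (toSet g) ≡ toSet (g [ i ]%= suc)
step⇒shift (x ∷ g) zero = t , ≤-refl ,
  trans (map-∷ʳ (shiftFrom t) t (toSet g))
        (cong₂ _∷ʳ_ (map-toSet-fixed g (λ j _ j≤ → shiftFrom-< (≤-trans (s≤s j≤) (top< x g))))
                    (shiftFrom-≥ {t} ≤-refl))
  where t = top (x ∷ g)
step⇒shift (x ∷ g) (suc i) with step⇒shift g i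
... | k , k≤ , eq = k , k≤t ,
  trans (map-∷ʳ (shiftFrom k) (top (x ∷ g)) (toSet g))
        (trans (cong₂ _∷ʳ_ eq (shiftFrom-≥ k≤t)) (sym (toSet-[suc]%=suc x g i)))
  where
  k≤t : k ≤ top (x ∷ g)
  k≤t = ≤-trans k≤ (<⇒≤ (top< x g))

-- The size of Inc as that of a neighbourhood, and the comparison of families

neighbours : ∀ {d} → Vec ℕ d → List (Vec ℕ d)
neighbours g = g ∷ List.tabulate (λ i → g [ i ]%= suc)

-- Different vectors can share neighbours; deduplication makes the length a cardinality.
neighbourhood : ∀ {d} → List (Vec ℕ d) → List (Vec ℕ d)
neighbourhood G = deduplicate (≡-dec _≟_) (concatMap neighbours G)

∈-neighbourhood⁺ : ∀ {d} {g h : Vec ℕ d} {G} → g ∈ G → h ∈ neighbours g → h ∈ neighbourhood G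
∈-neighbourhood⁺ g∈G h∈ = ∈-deduplicate⁺ (≡-dec _≟_) (∈-concatMap⁺ neighbours (lose g∈G h∈))

∈-neighbourhood⁻ : ∀ {d} {h : Vec ℕ d} G → h ∈ neighbourhood G →
  ∃ λ g → g ∈ G × (h ≡ g ⊎ ∃ λ i → h ≡ g [ i ]%= suc)
∈-neighbourhood⁻ G h∈ with find (∈-concatMap⁻ neighbours {xs = G} (∈-deduplicate⁻ (≡-dec _≟_) _ h∈))
... | g , g∈G , here h≡g = g , g∈G , inj₁ h≡g
... | g , g∈G , there h∈′ = g , g∈G , inj₂ (∈-tabulate⁻ h∈′)

neighbourhood-covers : ∀ {d} (G : List (Vec ℕ d)) → Covers (neighbourhood G) G
neighbourhood-covers G .base g∈   = ∈-neighbourhood⁺ g∈ (here refl)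
neighbourhood-covers G .step g∈ i = ∈-neighbourhood⁺ g∈ (there (∈-tabulate⁺ i))

neighbourhood⊆cover : ∀ {d} {N G : List (Vec ℕ d)} → Covers N G → neighbourhood G ⊆ N
neighbourhood⊆cover {G = G} cov h∈ with ∈-neighbourhood⁻ G h∈
... | g , g∈ , inj₁ refl       = base cov g∈
... | g , g∈ , inj₂ (i , refl) = step cov g∈ i

neighbourhood-unique : ∀ {d} (G : List (Vec ℕ d)) → Unique (neighbourhood G)
neighbourhood-unique G = DecUnique.deduplicate-! (≡-dec _≟_) (concatMap neighbours G)

Inc-size : ∀ {d} (G : List (Vec ℕ d)) → HasSize (Inc (map toSet G)) (length (neighbourhood G))
Inc-size G = map toSet (neighbourhood G) ,
  Unique.map⁺ toSet-injective (neighbourhood-unique G) ,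
  (λ v → mk⇔ (to v) (from v)) ,
  length-map toSet (neighbourhood G)
  where
  to : ∀ v → v ∈ map toSet (neighbourhood G) → Inc (map toSet G) v
  to v v∈ with ∈-map⁻ toSet v∈
  ... | h , h∈ , refl with ∈-neighbourhood⁻ G h∈
  -- A threshold just above the largest element fixes the whole set.
  ... | g , g∈ , inj₁ refl = toSet g , ∈-map⁺ toSet g∈ , shiftFrom (suc (top g)) , shiftFrom-inc1 (suc (top g)) ,
    map-toSet-fixed g (λ j _ j≤ → shiftFrom-< (s≤s j≤))
  ... | g , g∈ , inj₂ (i , refl) with step⇒shift g i
  ... | k , _ , eq = toSet g , ∈-map⁺ toSet g∈ , shiftFrom k , shiftFrom-inc1 k , eq
  from : ∀ v → Inc (map toSet G) v → v ∈ map toSet (neighbourhood G)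
  from v (u , u∈ , π , isπ , refl) with ∈-map⁻ toSet u∈
  ... | g , g∈ , refl with inc1⇒step g isπ
  ... | inj₁ eq       = subst (_∈ _) (sym eq) (∈-map⁺ toSet (base (neighbourhood-covers G) g∈))
  ... | inj₂ (i , eq) = subst (_∈ _) (sym eq) (∈-map⁺ toSet (step (neighbourhood-covers G) g∈ i))

gaps : ∀ {d} (F : List (Vec ℕ d)) → (∀ u → u ∈ F → IsDSet u) → ∃ λ G → map toSet G ≡ F
gaps []      _ = [] , refl
gaps (u ∷ F) isD with toSet-surjective u (isD u (here refl)) | gaps F (λ v → isD v ∘ there)
... | g , eq | G , eqs = g ∷ G , cong₂ _∷_ eq eqs

sums-bounded : ∀ {d} (G : List (Vec ℕ d)) → ∃ λ m → ∀ {g} → g ∈ G → sum g ≤ m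
sums-bounded []      = 0 , λ ()
sums-bounded (h ∷ G) with sums-bounded G
... | m , ≤m = sum h ⊔ m , λ
  { (here refl) → m≤m⊔n (sum h) m
  ; (there g∈)  → ≤-trans (≤m g∈) (m≤n⊔m (sum h) m) }

-- Were `g` missing from `G`, compressedness would give `toSet h ≺ toSet g`, contrary to `⊏⇒⊀`.
compressed⇒initial : ∀ {d} m {G : List (Vec ℕ d)} → Compressed (map toSet G) → InitialIn m G
compressed⇒initial m {G} comp {g} {h} h∈G _ g⊏h with g ∈? G
  where open import Data.List.Membership.DecPropositional (≡-dec _≟_) using (_∈?_)
... | yes g∈G = g∈G
... | no  g∉G = ⊥-elim (⊏⇒⊀ g⊏h (comp (toSet h) (toSet g) (∈-map⁺ toSet h∈G) (toSet-IsDSet g) toSet-g∉))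
  where
  toSet-g∉ : ¬ (toSet g ∈ map toSet G)
  toSet-g∉ g∈ with ∈-map⁻ toSet g∈
  ... | g′ , g′∈G , eq = g∉G (subst (_∈ G) (sym (toSet-injective eq)) g′∈G)

theorem1p4 : (d : ℕ) → 1 ≤ d → (F : List (Vec ℕ d)) → IsFamily F → Compressed F →
    (F' : List (Vec ℕ d)) → IsFamily F' → length F' ≡ length F →
    ∃ λ (n : ℕ) → ∃ λ (n' : ℕ) → HasSize (Inc F) n × HasSize (Inc F') n' × n ≤ n'
theorem1p4 d _ F (uF , isD) comp F' (uF' , isD') size with gaps F isD | gaps F' isD'
... | G , refl | G′ , refl =
  length (neighbourhood G) , length (neighbourhood G′) , Inc-size G , Inc-size G′ , bound
  where
  bound : length (neighbourhood G) ≤ length (neighbourhood G′)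
  bound with sums-bounded G
  -- The same `m`, a bound for the sums in `G`, serves in the lower bound for `G′`, so both sides
  -- meet at the same number.
  ... | m , ≤m with initial-cover d m (Unique.map⁻ uF) ≤m (compressed⇒initial m comp)
  ... | N , cov , N≤ = begin
    length (neighbourhood G)       ≤⟨ ⊆⇒length≤ (neighbourhood-unique G) (neighbourhood⊆cover cov) ⟩
    length N                       ≤⟨ N≤ ⟩
    length G + gain d m (length G) ≡⟨ cong (λ n → n + gain d m n) G≡G′ ⟩
    length G′ + gain d m (length G′) ≤⟨ cover-length d m (Unique.map⁻ uF') (neighbourhood-covers G′) ⟩
    length (neighbourhood G′) ∎
    where
    G≡G′ : length G ≡ length G′
    G≡G′ = trans (sym (length-map toSet G)) (trans (sym size) (length-map toSet G′))
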